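{- Let $n\ge 2$ and let $a_1,\ldots,a_{n-1}$ be positive integers, $\lambda=\sum_{i=1}^{n-1}a_i\omega_i$. For every $1\le i\le n-1$ choose a vertex $v_i$ of the polytope $P_{a_i\omega_i}$. Then the point $v_1+\ldots+v_{n-1}$ is a vertex of $P_\lambda$ if and only if for every $1\le i\le n-2$ the point $v_i+v_{i+1}$ is a vertex of the Minkowski sum $P_{a_i\omega_i}+P_{a_{i+1}\omega_{i+1}}$.
   Context: FFLV polytopes of type $A$: for nonnegative integers $b_1,\ldots,b_{n-1}$ and the $\mathfrak{sl}_n$-weight $\mu=\sum b_i\omega_i$ ($\omega_i$ the fundamental weights), let $U=\mathbb R^{\binom n2}$ with coordinates $x_{i,j}$, $1\le i<j\le n$. A Dyck path is a sequence $d=((i_1,j_1),\ldots,(i_N,j_N))$ of pairs with $1\le i_k<j_k\le n$, $j_1-i_1=j_N-i_N=1$, and for each $k<N$, $(i_{k+1},j_{k+1})$ equals $(i_k+1,j_k)$ or $(i_k,j_k+1)$. Put $S(x,d)=\sum_{(i,j)\in d}x_{i,j}$ and $M(\mu,d)=b_{i_1}+b_{i_1+1}+\ldots+b_{i_N}$. Then $P_\mu=\{x\in U: x_{i,j}\ge 0 \text{ for all } i<j,\ S(x,d)\le M(\mu,d)\text{ for all Dyck paths } d\}$. In particular $P_{a_i\omega_i}$ is this polytope for the weight with only the $i$-th coordinate nonzero and equal to $a_i$; $P_\lambda=P_{a_1\omega_1}+\ldots+P_{a_{n-1}\omega_{n-1}}$.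
   Formalization: The polytopes are taken in rational rather than real coordinate space: the vertices v_i, the points of the Minkowski sums and of P_λ, and the convex-combination parameters defining a vertex are all rational. -}

module Defs where

open import Data.Nat as ℕ using (ℕ; suc; _∸_; _≡ᵇ_)
open import Data.Integer using (+_)
open import Data.Rational using (ℚ; 0ℚ; 1ℚ; _+_; _*_; _-_; _≤_; _<_; _/_)
open import Data.List using (List; []; _∷_; map; upTo; foldr)
open import Data.List.NonEmpty using (List⁺; head; last; toList)
open import Data.List.Relation.Unary.All using (All)
open import Data.List.Relation.Unary.Linked using (Linked)
open import Data.Product using (Σ; _×_; proj₁; proj₂; ∃)
open import Data.Sum using (_⊎_)
open import Data.Bool using (if_then_else_)
open import Relation.Binary.PropositionalEquality using (_≡_)

-- Points of U = ℝ^{n choose 2}: coordinates x i j, meaningful for 1 ≤ i < j ≤ n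
-- (1-based indices as in the paper); other entries are ignored.
Pt : Set
Pt = ℕ → ℕ → ℚ

ValidIdx : ℕ → ℕ × ℕ → Set
ValidIdx n p = (1 ℕ.≤ proj₁ p) × ((proj₁ p ℕ.< proj₂ p) × (proj₂ p ℕ.≤ n))

_≐[_]_ : Pt → ℕ → Pt → Set
x ≐[ n ] y = ∀ i j → 1 ℕ.≤ i → i ℕ.< j → j ℕ.≤ n → x i j ≡ y i j

_+ₚ_ : Pt → Pt → Pt
(x +ₚ y) i j = x i j + y i j

_·ₚ_ : ℚ → Pt → Pt
(t ·ₚ x) i j = t * x i j

zeroₚ : Pt
zeroₚ i j = 0ℚ

sumPts : (ℕ → Pt) → ℕ → ℕ → Pt
sumPts f lo hi = foldr (λ k acc → f (lo ℕ.+ k) +ₚ acc) zeroₚ (upTo (suc hi ∸ lo))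

rangeSum : (ℕ → ℕ) → ℕ → ℕ → ℕ
rangeSum b lo hi = foldr (λ k acc → b (lo ℕ.+ k) ℕ.+ acc) 0 (upTo (suc hi ∸ lo))

DyckStep : ℕ × ℕ → ℕ × ℕ → Set
DyckStep p q = ((proj₁ q ≡ suc (proj₁ p)) × (proj₂ q ≡ proj₂ p))
             ⊎ ((proj₁ q ≡ proj₁ p) × (proj₂ q ≡ suc (proj₂ p)))

IsDyck : ℕ → List⁺ (ℕ × ℕ) → Set
IsDyck n d = All (ValidIdx n) (toList d)
           × ((proj₂ (head d) ≡ suc (proj₁ (head d)))
           × ((proj₂ (last d) ≡ suc (proj₁ (last d)))
           × Linked DyckStep (toList d)))

S : Pt → List⁺ (ℕ × ℕ) → ℚ
S x d = foldr (λ p acc → x (proj₁ p) (proj₂ p) + acc) 0ℚ (toList d)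

-- weights μ = Σ b_i ω_i given by b : ℕ → ℕ, b i = b_i (1-based)
M : (ℕ → ℕ) → List⁺ (ℕ × ℕ) → ℕ
M b d = rangeSum b (proj₁ (head d)) (proj₁ (last d))

ℕtoℚ : ℕ → ℚ
ℕtoℚ m = + m / 1

FFLV : ℕ → (ℕ → ℕ) → Pt → Set
FFLV n b x = (∀ i j → 1 ℕ.≤ i → i ℕ.< j → j ℕ.≤ n → 0ℚ ≤ x i j)
           × (∀ d → IsDyck n d → S x d ≤ ℕtoℚ (M b d))

single : ℕ → ℕ → (ℕ → ℕ)
single i a k = if k ≡ᵇ i then a else 0

Mink : ℕ → (Pt → Set) → (Pt → Set) → Pt → Set
Mink n P Q x = Σ Pt λ y → Σ Pt λ z → P y × (Q z × (x ≐[ n ] (y +ₚ z)))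

IsVertex : ℕ → (Pt → Set) → Pt → Set
IsVertex n P x = P x ×
  (∀ y z t → P y → P z → 0ℚ < t → t < 1ℚ →
     x ≐[ n ] ((t ·ₚ y) +ₚ ((1ℚ - t) ·ₚ z)) → y ≐[ n ] z)

{-# OPTIONS --safe #-}
module Submission where

open import Defs
open import Data.Bool as Bool using (Bool; true; false; if_then_else_; not; _∧_; _∨_)
open import Data.Empty using (⊥; ⊥-elim)
import Data.Integer as ℤ
import Data.Integer.Properties as ℤₚ
open import Data.List using (List; []; _∷_; foldr; applyUpTo; initLast; _∷ʳ′_)
open import Data.List.NonEmpty using (_∷_; last)
open import Data.List.Relation.Unary.All using (All; []; _∷_)
open import Data.List.Relation.Unary.Linked using (Linked; [-]; _∷_)
open import Data.Nat as ℕ using (ℕ; zero; suc; _∸_; _≤_; _<_; z≤n; s≤s)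
import Data.Nat.Coprimality as Coprime
import Data.Nat.Properties as ℕₚ
open import Data.Product using (Σ; _×_; _,_; proj₁; proj₂; ∃)
open import Data.Rational as ℚ using (ℚ; 0ℚ; 1ℚ; ½; _+_; _*_; _-_; -_; _⊔_; _⊓_)
import Data.Rational.Properties as ℚₚ
open import Data.Rational.Solver using (module +-*-Solver)
open import Data.Sum using (_⊎_; inj₁; inj₂; swap)
open import Function using (_∘_; id)
open import Function.Bundles using (_⇔_; mk⇔)
open import Relation.Binary.PropositionalEquality
open import Relation.Nullary using (¬_; Dec; does; yes; no; _×-dec_; _⊎-dec_; ¬?; contradiction)
open import Relation.Nullary.Decidable using (dec-true; dec-false; decidable-stable; map′)

-- Order the pairs (k , l) componentwise. A vertex of P_{a_i ω_i} is a_i times the indicator of an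
-- antichain A_i in the rectangle R_i = {k ≤ i < l}, as one sees by cutting a point of the polytope at
-- half of the height a_i of its last-passage function.
--
-- If v_i + v_{i+1} is a vertex of the Minkowski sum, then no part of the symmetric difference of A_i
-- and A_{i+1} can be exchanged between the two antichains. Such a part is a union of components of the
-- comparability graph inside R_i ∩ R_{i+1}. It follows that a ≤ b for all comparable a ∈ A_i,
-- b ∈ A_{i+1}, and that every point of some A_i lies on a tight Dyck path, one that meets A_s for all s
-- in its range.
--
-- Suppose now that the sum of the v_i is a proper convex combination of y and z in P_λ. Then δ = y - z
-- vanishes where all v_i do and sums to zero along tight paths. Let h_i(p), for p ∈ A_i, be the sum of δ
-- along a tight path up to p. For a < b as above, h_{i+1}(b) - δ(b) = h_i(a), so this number is constant
-- on components, and rigidity forces it to be 0: h_i = 0 on A_i \ A_{i+1} and h_{i+1} = δ on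
-- A_{i+1} \ A_i. Since h_i(p) = h_{i+1}(p) on common points, following p through the antichains that
-- contain it gives δ(p) = 0.
--
-- Conversely, a decomposition of v_i + v_{i+1} yields one of the whole sum by adding the other v_j.

-- Lattice paths in the triangle

data Path (k l : ℕ) : ℕ → ℕ → Set where
  stop  : Path k l k l
  -- Only a step in the first coordinate can leave the triangle `k < l`, hence a condition here and
  -- none in `up`.
  right : ∀ {k′ l′} → suc k < l → Path (suc k) l k′ l′ → Path k l k′ l′
  up    : ∀ {k′ l′} → Path k (suc l) k′ l′ → Path k l k′ l′

_++ₚ_ : ∀ {k l k′ l′ k″ l″} → Path k l k′ l′ → Path k′ l′ k″ l″ → Path k l k″ l″
stop      ++ₚ ρ = ρ
right c π ++ₚ ρ = right c (π ++ₚ ρ)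
up π      ++ₚ ρ = up (π ++ₚ ρ)

path-≤ : ∀ {k l k′ l′} → Path k l k′ l′ → k ≤ k′ × l ≤ l′
path-≤ stop        = ℕₚ.≤-refl , ℕₚ.≤-refl
path-≤ (right c π) = let p , q = path-≤ π in ℕₚ.<⇒≤ p , q
path-≤ (up π)      = let p , q = path-≤ π in p , ℕₚ.<⇒≤ q

horizontal : ∀ {k k′ l} → k ≤ k′ → k′ < l → Path k l k′ l
horizontal {k} {k′} {l} k≤k′ k′<l with ℕₚ.m≤n⇒∃[o]m+o≡n k≤k′
... | d , refl = go d k k′<l
  where
  go : ∀ d k → k ℕ.+ d < l → Path k l (k ℕ.+ d) l
  go zero    k c rewrite ℕₚ.+-identityʳ k = stop
  go (suc d) k c rewrite ℕₚ.+-suc k d     =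
    right (ℕₚ.≤-<-trans (s≤s (ℕₚ.m≤m+n k d)) c) (go d (suc k) c)

vertical : ∀ {k l l′} → l ≤ l′ → Path k l k l′
vertical {k} {l} {l′} l≤l′ with ℕₚ.m≤n⇒∃[o]m+o≡n l≤l′
... | d , refl = go d l
  where
  go : ∀ d l → Path k l k (l ℕ.+ d)
  go zero    l rewrite ℕₚ.+-identityʳ l = stop
  go (suc d) l rewrite ℕₚ.+-suc l d     = up (go d (suc l))

route : ∀ {k l k′ l′} → k ≤ k′ → l ≤ l′ → k′ < l′ → Path k l k′ l′
route k≤k′ l≤l′ k′<l′ = vertical l≤l′ ++ₚ horizontal k≤k′ k′<l′

-- Leaving out the starting point makes this sum additive under concatenation, where the common
-- point must be counted only once.
after : Pt → ∀ {k l k′ l′} → Path k l k′ l′ → ℚ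
after x stop                        = 0ℚ
after x {k} {l} (right _ π) = x (suc k) l + after x π
after x {k} {l} (up π)      = x k (suc l) + after x π

total : Pt → ∀ {k l k′ l′} → Path k l k′ l′ → ℚ
total x {k} {l} π = x k l + after x π

after-++ : ∀ x {k l k′ l′ k″ l″} (π : Path k l k′ l′) (ρ : Path k′ l′ k″ l″) →
           after x (π ++ₚ ρ) ≡ after x π + after x ρ
after-++ x stop        ρ = sym (ℚₚ.+-identityˡ _)
after-++ x {k} {l} (right _ π) ρ =
  trans (cong (x (suc k) l +_) (after-++ x π ρ)) (sym (ℚₚ.+-assoc (x (suc k) l) (after x π) (after x ρ)))
after-++ x {k} {l} (up π)      ρ =
  trans (cong (x k (suc l) +_) (after-++ x π ρ)) (sym (ℚₚ.+-assoc (x k (suc l)) (after x π) (after x ρ)))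

total-++ : ∀ x {k l k′ l′ k″ l″} (π : Path k l k′ l′) (ρ : Path k′ l′ k″ l″) →
           total x (π ++ₚ ρ) ≡ total x π + after x ρ
total-++ x {k} {l} π ρ =
  trans (cong (x k l +_) (after-++ x π ρ)) (sym (ℚₚ.+-assoc (x k l) (after x π) (after x ρ)))

-- Dyck paths as lists and as lattice paths

InTri : ℕ → ℕ → ℕ → Set
InTri n k l = 1 ≤ k × k < l × l ≤ n

points : ∀ {k l k′ l′} → Path k l k′ l′ → List (ℕ × ℕ)
points stop                = []
points {k} {l} (right _ π) = (suc k , l) ∷ points π
points {k} {l} (up π)      = (k , suc l) ∷ points π

S-points : ∀ x {k l k′ l′} (π : Path k l k′ l′) → S x ((k , l) ∷ points π) ≡ total x π
S-points x stop        = refl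
S-points x {k} {l} (right _ π) = cong (x k l +_) (S-points x π)
S-points x {k} {l} (up π)      = cong (x k l +_) (S-points x π)

last-∷ : ∀ {A : Set} (x y : A) ys → last (x ∷ y ∷ ys) ≡ last (y ∷ ys)
last-∷ x y ys with initLast ys
... | []       = refl
... | _ ∷ʳ′ _ = refl

last-points : ∀ {k l k′ l′} (π : Path k l k′ l′) → last ((k , l) ∷ points π) ≡ (k′ , l′)
last-points stop        = refl
last-points (right _ π) = trans (last-∷ _ _ (points π)) (last-points π)
last-points (up π)      = trans (last-∷ _ _ (points π)) (last-points π)

points-linked : ∀ {k l k′ l′} (π : Path k l k′ l′) → Linked DyckStep ((k , l) ∷ points π)
points-linked stop        = [-]
points-linked (right _ π) = inj₁ (refl , refl) ∷ points-linked π
points-linked (up π)      = inj₂ (refl , refl) ∷ points-linked π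

points-valid : ∀ {n k l k′ l′} → 1 ≤ k → k < l → l′ ≤ n → (π : Path k l k′ l′) →
               All (ValidIdx n) ((k , l) ∷ points π)
points-valid 1≤k k<l l′≤n stop        = (1≤k , k<l , l′≤n) ∷ []
points-valid 1≤k k<l l′≤n (right c π) =
  (1≤k , k<l , ℕₚ.≤-trans (proj₂ (path-≤ π)) l′≤n) ∷ points-valid (ℕₚ.m≤n⇒m≤1+n 1≤k) c l′≤n π
points-valid 1≤k k<l l′≤n (up π)      =
  (1≤k , k<l , ℕₚ.≤-trans (ℕₚ.<⇒≤ (proj₂ (path-≤ π))) l′≤n) ∷ points-valid 1≤k (ℕₚ.m≤n⇒m≤1+n k<l) l′≤n π

from-linked : ∀ {n} k l ps → All (ValidIdx n) ((k , l) ∷ ps) → Linked DyckStep ((k , l) ∷ ps) →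
              ∃ λ k′ → ∃ λ l′ → Σ (Path k l k′ l′) λ π → points π ≡ ps
from-linked k l [] _ _ = k , l , stop , refl
from-linked k l ((_ , _) ∷ ps) (_ ∷ (v ∷ vs)) (inj₁ (refl , refl) ∷ st)
  with from-linked _ _ ps (v ∷ vs) st
... | k′ , l′ , π , refl = k′ , l′ , right (proj₁ (proj₂ v)) π , refl
from-linked k l ((_ , _) ∷ ps) (_ ∷ vs) (inj₂ (refl , refl) ∷ st)
  with from-linked _ _ ps vs st
... | k′ , l′ , π , refl = k′ , l′ , up π , refl

DyckPath : ℕ → ℕ → Set
DyckPath j j′ = Path j (suc j) j′ (suc j′)

end-valid : ∀ {n k l k′ l′} (π : Path k l k′ l′) → All (ValidIdx n) ((k , l) ∷ points π) → l′ ≤ n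
end-valid stop        ((_ , _ , c) ∷ _) = c
end-valid (right _ π) (_ ∷ vs)          = end-valid π vs
end-valid (up π)      (_ ∷ vs)          = end-valid π vs

-- Abstract, so that conversion checking never unfolds the gcd behind ℕtoℚ.
abstract
  toℚ : ℕ → ℚ
  toℚ = ℕtoℚ

  toℚ≡ : ∀ m → toℚ m ≡ ℕtoℚ m
  toℚ≡ m = refl

module _ (n : ℕ) (b : ℕ → ℕ) (x : Pt) where

  FFLV-path : FFLV n b x → ∀ {j j′} → 1 ≤ j → j′ < n → (π : DyckPath j j′) →
              total x π ℚ.≤ toℚ (rangeSum b j j′)
  FFLV-path (_ , dyck) {j} {j′} 1≤j j′<n π =
    subst₂ ℚ._≤_ (S-points x π) (trans (cong (λ q → ℕtoℚ (rangeSum b j (proj₁ q))) (last-points π)) (sym (toℚ≡ (rangeSum b j j′))))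
      (dyck ((j , suc j) ∷ points π)
        ( points-valid 1≤j ℕₚ.≤-refl j′<n π , refl
        , subst (λ q → proj₂ q ≡ suc (proj₁ q)) (sym (last-points π)) refl
        , points-linked π))

  -- Converse of `FFLV-path`. A list is first turned into a lattice path with an arbitrary end; the
  -- condition on its last point then shows that the end is next to the diagonal, so that the path
  -- is a `DyckPath`.
  path-FFLV : (∀ k l → InTri n k l → 0ℚ ℚ.≤ x k l) →
              (∀ {j j′} → 1 ≤ j → j′ < n → (π : DyckPath j j′) →
                total x π ℚ.≤ toℚ (rangeSum b j j′)) →
              FFLV n b x
  path-FFLV nonneg bound = (λ k l p q r → nonneg k l (p , q , r)) , dyck
    where
    dyck : ∀ d → IsDyck n d → S x d ℚ.≤ ℕtoℚ (M b d)
    dyck ((k , .(suc k)) ∷ ps) (valid , refl , end , linked) =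
      let k′ , l′ , π , eq = from-linked k (suc k) ps valid linked in
      close π eq valid (trans (sym (cong proj₂ (end-of π eq))) (trans end (cong (suc ∘ proj₁) (end-of π eq))))
      where
      end-of : ∀ {k′ l′ ps} (π : Path k (suc k) k′ l′) → points π ≡ ps → last ((k , suc k) ∷ ps) ≡ (k′ , l′)
      end-of π refl = last-points π

      close : ∀ {k′ l′ ps} (π : Path k (suc k) k′ l′) → points π ≡ ps →
              All (ValidIdx n) ((k , suc k) ∷ ps) → l′ ≡ suc k′ →
              S x ((k , suc k) ∷ ps) ℚ.≤ ℕtoℚ (M b ((k , suc k) ∷ ps))
      close π refl vs@((1≤k , _) ∷ _) refl =
        subst₂ ℚ._≤_ (sym (S-points x π)) (trans (toℚ≡ _) (cong (λ q → ℕtoℚ (rangeSum b k (proj₁ q))) (sym (last-points π))))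
          (bound 1≤k (end-valid π vs) π)

+-interchange : ∀ p q r s → (p + q) + (r + s) ≡ (p + r) + (q + s)
+-interchange = solve 4 (λ p q r s → (p :+ q) :+ (r :+ s) := (p :+ r) :+ (q :+ s)) refl
  where open +-*-Solver

-- Finite sums of rationals

sumℚ : ℕ → (ℕ → ℚ) → ℚ
sumℚ zero    f = 0ℚ
sumℚ (suc m) f = f 0 + sumℚ m (f ∘ suc)

sumℚ-cong : ∀ m {f g} → (∀ s → s < m → f s ≡ g s) → sumℚ m f ≡ sumℚ m g
sumℚ-cong zero    eq = refl
sumℚ-cong (suc m) eq = cong₂ _+_ (eq 0 (s≤s z≤n)) (sumℚ-cong m (λ s s<m → eq (suc s) (s≤s s<m)))

sumℚ-mono : ∀ m {f g} → (∀ s → s < m → f s ℚ.≤ g s) → sumℚ m f ℚ.≤ sumℚ m g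
sumℚ-mono zero    le = ℚₚ.≤-refl
sumℚ-mono (suc m) le = ℚₚ.+-mono-≤ (le 0 (s≤s z≤n)) (sumℚ-mono m (λ s s<m → le (suc s) (s≤s s<m)))

sumℚ-zero : ∀ m {f} → (∀ s → s < m → f s ≡ 0ℚ) → sumℚ m f ≡ 0ℚ
sumℚ-zero zero    eq = refl
sumℚ-zero (suc m) eq =
  cong₂ _+_ (eq 0 (s≤s z≤n)) (sumℚ-zero m (λ s s<m → eq (suc s) (s≤s s<m)))

sumℚ-+ : ∀ m f g → sumℚ m (λ s → f s + g s) ≡ sumℚ m f + sumℚ m g
sumℚ-+ zero    f g = refl
sumℚ-+ (suc m) f g = trans (cong ((f 0 + g 0) +_) (sumℚ-+ m (f ∘ suc) (g ∘ suc)))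
  (+-interchange (f 0) (g 0) (sumℚ m (f ∘ suc)) (sumℚ m (g ∘ suc)))

sumℚ-* : ∀ m c f → sumℚ m (λ s → c * f s) ≡ c * sumℚ m f
sumℚ-* zero    c f = sym (ℚₚ.*-zeroʳ c)
sumℚ-* (suc m) c f = trans (cong ((c * f 0) +_) (sumℚ-* m c (f ∘ suc)))
  (sym (ℚₚ.*-distribˡ-+ c (f 0) (sumℚ m (f ∘ suc))))

sumℚ-swap : ∀ m n (f : ℕ → ℕ → ℚ) →
            sumℚ m (λ s → sumℚ n (f s)) ≡ sumℚ n (λ t → sumℚ m (λ s → f s t))
sumℚ-swap zero    n f = sym (sumℚ-zero n (λ _ _ → refl))
sumℚ-swap (suc m) n f = trans (cong (sumℚ n (f 0) +_) (sumℚ-swap m n (f ∘ suc)))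
  (sym (sumℚ-+ n (f 0) (λ t → sumℚ m (λ s → f (suc s) t))))

sumℚ-pick : ∀ m s f → s < m → (∀ t → t ≢ s → f t ≡ 0ℚ) → sumℚ m f ≡ f s
sumℚ-pick (suc m) zero    f _         z =
  trans (cong (f 0 +_) (sumℚ-zero m (λ t _ → z (suc t) λ ()))) (ℚₚ.+-identityʳ (f 0))
sumℚ-pick (suc m) (suc s) f (s≤s s<m) z =
  trans (cong₂ _+_ (z 0 λ ()) (sumℚ-pick m s (f ∘ suc) s<m (λ t t≢s → z (suc t) (t≢s ∘ ℕₚ.suc-injective))))
        (ℚₚ.+-identityˡ (f (suc s)))

sumℚ-pick₂ : ∀ m s f → suc s < m → (∀ t → t ≢ s → t ≢ suc s → f t ≡ 0ℚ) →
             sumℚ m f ≡ f s + f (suc s)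
sumℚ-pick₂ (suc m) zero    f (s≤s 0<m) z =
  cong (f 0 +_) (sumℚ-pick m 0 (f ∘ suc) 0<m (λ t t≢0 → z (suc t) (λ ()) (t≢0 ∘ ℕₚ.suc-injective)))
sumℚ-pick₂ (suc m) (suc s) f (s≤s s<m) z =
  trans (cong₂ _+_ (z 0 (λ ()) (λ ()))
          (sumℚ-pick₂ m s (f ∘ suc) s<m
            (λ t t≢s t≢1+s → z (suc t) (t≢s ∘ ℕₚ.suc-injective) (t≢1+s ∘ ℕₚ.suc-injective))))
        (ℚₚ.+-identityˡ (f (suc s) + f (suc (suc s))))

sumPts≡sumℚ : ∀ f m k l → sumPts f 1 m k l ≡ sumℚ m (λ s → f (suc s) k l)
sumPts≡sumℚ f m k l = go m id
  where
  go : ∀ m g → foldr (λ s acc → f (suc s) +ₚ acc) zeroₚ (applyUpTo g m) k l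
             ≡ sumℚ m (λ s → f (suc (g s)) k l)
  go zero    g = refl
  go (suc m) g = cong (f (suc (g 0)) k l +_) (go m (g ∘ suc))

-- Weights of paths

abstract
  toℚ-0 : toℚ 0 ≡ 0ℚ
  toℚ-0 = toℚ≡ 0

  toℚ-1 : toℚ 1 ≡ 1ℚ
  toℚ-1 = toℚ≡ 1

  toℚ-+ : ∀ m n → toℚ (m ℕ.+ n) ≡ toℚ m + toℚ n
  toℚ-+ m n = trans (toℚ≡ (m ℕ.+ n)) (sym (trans (cong₂ _+_ (normal m) (normal n))
    (cong (ℚ._/ 1) (cong₂ ℤ._+_ (ℤₚ.*-identityʳ (ℤ.+ m)) (ℤₚ.*-identityʳ (ℤ.+ n))))))
    where
    coprime-1 : ∀ m → Coprime.Coprime m 1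
    coprime-1 m = Coprime.sym (Coprime.1-coprimeTo m)
    normal : ∀ m → toℚ m ≡ ℚ.mkℚ (ℤ.+ m) 0 (coprime-1 m)
    normal m = trans (toℚ≡ m) (ℚₚ.normalize-coprime (coprime-1 m))

  toℚ-nonneg : ∀ m → 0ℚ ℚ.≤ toℚ m
  toℚ-nonneg m = subst (0ℚ ℚ.≤_) (sym (toℚ≡ m)) (ℚₚ.nonNegative⁻¹ (ℕtoℚ m) {{ℚₚ.normalize-nonNeg m 1}})

  toℚ-pos : ∀ {m} → 0 < m → 0ℚ ℚ.< toℚ m
  toℚ-pos {suc m} _ = subst (0ℚ ℚ.<_) (sym (toℚ≡ (suc m))) (ℚₚ.positive⁻¹ (ℕtoℚ (suc m)) {{ℚₚ.normalize-pos (suc m) 1}})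

rangeSum≡sumℚ : ∀ b lo hi → toℚ (rangeSum b lo hi) ≡ sumℚ (suc hi ∸ lo) (λ s → toℚ (b (lo ℕ.+ s)))
rangeSum≡sumℚ b lo hi = go (suc hi ∸ lo) id
  where
  go : ∀ m g → toℚ (foldr (λ s acc → b (lo ℕ.+ s) ℕ.+ acc) 0 (applyUpTo g m))
             ≡ sumℚ m (λ s → toℚ (b (lo ℕ.+ g s)))
  go zero    g = toℚ-0
  go (suc m) g = trans (toℚ-+ (b (lo ℕ.+ g 0)) _) (cong (toℚ (b (lo ℕ.+ g 0)) +_) (go m (g ∘ suc)))

single-≡ : ∀ i a → single i a i ≡ a
single-≡ zero    a = refl
single-≡ (suc i) a = single-≡ i a

single-≢ : ∀ i a {k} → k ≢ i → single i a k ≡ 0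
single-≢ zero    a {zero}  k≢i = ⊥-elim (k≢i refl)
single-≢ zero    a {suc k} k≢i = refl
single-≢ (suc i) a {zero}  k≢i = refl
single-≢ (suc i) a {suc k} k≢i = single-≢ i a (k≢i ∘ cong suc)

single-0 : ∀ i a k → k ≢ i → toℚ (single i a k) ≡ 0ℚ
single-0 i a k k≢i = trans (cong toℚ (single-≢ i a k≢i)) toℚ-0

weight-in : ∀ i a lo hi → lo ≤ i → i ≤ hi → toℚ (rangeSum (single i a) lo hi) ≡ toℚ a
weight-in i a lo hi lo≤i i≤hi =
  trans (rangeSum≡sumℚ (single i a) lo hi)
    (trans (sumℚ-pick (suc hi ∸ lo) (i ∸ lo) _ (ℕₚ.∸-monoˡ-< (s≤s i≤hi) lo≤i)
              (λ t t≢ → single-0 i a (lo ℕ.+ t) (λ eq → t≢ (trans (sym (ℕₚ.m+n∸m≡n lo t)) (cong (_∸ lo) eq)))))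
      (cong toℚ (trans (cong (single i a) (ℕₚ.m+[n∸m]≡n lo≤i)) (single-≡ i a))))

<∸⇒+≤ : ∀ {lo hi s} → s < suc hi ∸ lo → lo ℕ.+ s ≤ hi
<∸⇒+≤ {lo} {hi} {s} s< = ℕₚ.≤-pred (ℕₚ.≤-trans (ℕₚ.≤-reflexive (sym (ℕₚ.+-suc lo s)))
  (ℕₚ.≤-trans (ℕₚ.+-monoʳ-≤ lo s<) (ℕₚ.≤-reflexive (ℕₚ.m+[n∸m]≡n
    (ℕₚ.<⇒≤ (ℕₚ.m∸n≢0⇒n<m {suc hi} {lo} (λ eq → ℕₚ.n≮0 (subst (s <_) eq s<))))))))

weight-out : ∀ i a lo hi → i < lo ⊎ hi < i → toℚ (rangeSum (single i a) lo hi) ≡ 0ℚ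
weight-out i a lo hi out = trans (rangeSum≡sumℚ (single i a) lo hi)
  (sumℚ-zero (suc hi ∸ lo) (λ s s< → single-0 i a (lo ℕ.+ s) (λ { refl → absurd s< out })))
  where
  absurd : ∀ {s} → s < suc hi ∸ lo → lo ℕ.+ s < lo ⊎ hi < lo ℕ.+ s → ⊥
  absurd s< (inj₁ c) = ℕₚ.m+n≮m lo _ c
  absurd s< (inj₂ c) = ℕₚ.<⇒≱ c (<∸⇒+≤ s<)

in-or-out : ∀ i lo hi → (lo ≤ i × i ≤ hi) ⊎ (i < lo ⊎ hi < i)
in-or-out i lo hi with ℕₚ.≤-<-connex lo i | ℕₚ.≤-<-connex i hi
... | inj₁ p | inj₁ q = inj₁ (p , q)
... | inj₁ p | inj₂ q = inj₂ (inj₂ q)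
... | inj₂ p | _      = inj₂ (inj₁ p)

weight-≤ : ∀ i a lo hi → toℚ (rangeSum (single i a) lo hi) ℚ.≤ toℚ a
weight-≤ i a lo hi with in-or-out i lo hi
... | inj₁ (p , q) = ℚₚ.≤-reflexive (weight-in i a lo hi p q)
... | inj₂ out     = ℚₚ.≤-trans (ℚₚ.≤-reflexive (weight-out i a lo hi out)) (toℚ-nonneg a)

-- The bound of a Dyck path is linear in the weight: write each coefficient as a sum over the
-- fundamental weights, only one of which contributes, and exchange the two summations.
weight-split : ∀ a m {lo hi} → 1 ≤ lo → hi ≤ m →
  toℚ (rangeSum a lo hi) ≡ sumℚ m (λ s → toℚ (rangeSum (single (suc s) (a (suc s))) lo hi))
weight-split a m {lo@(suc lo′)} {hi} _ hi≤m =
  trans (rangeSum≡sumℚ a lo hi)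
    (trans (sumℚ-cong (suc hi ∸ lo) (λ s s< → sym (entry (lo′ ℕ.+ s) (ℕₚ.≤-trans (<∸⇒+≤ s<) hi≤m))))
      (trans (sumℚ-swap (suc hi ∸ lo) m (λ s t → toℚ (single (suc t) (a (suc t)) (lo ℕ.+ s))))
        (sumℚ-cong m (λ t _ → sym (rangeSum≡sumℚ (single (suc t) (a (suc t))) lo hi)))))
  where
  entry : ∀ k → k < m → sumℚ m (λ t → toℚ (single (suc t) (a (suc t)) (suc k))) ≡ toℚ (a (suc k))
  entry k k<m = trans (sumℚ-pick m k _ k<m
      (λ t t≢k → single-0 (suc t) (a (suc t)) (suc k) (λ eq → t≢k (sym (ℕₚ.suc-injective eq)))))
    (cong toℚ (single-≡ (suc k) (a (suc k))))

-- Path sums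

-- The vanishing hypothesis concerns the whole rectangle between the two ends, not just the points
-- of `π`, so it passes to the tail of a path by shrinking the rectangle. `total-end` and
-- `after-end` have the same form.
after-null : ∀ x {k l k′ l′} → k < l → (π : Path k l k′ l′) →
  (∀ r t → r < t → k ≤ r → l ≤ t → r ≤ k′ → t ≤ l′ → ¬ (r ≡ k × t ≡ l) → x r t ≡ 0ℚ) → after x π ≡ 0ℚ
after-null x k<l stop null = refl
after-null x {k} {l} k<l (right c π) null = cong₂ _+_
  (null (suc k) l c (ℕₚ.n≤1+n k) ℕₚ.≤-refl (proj₁ (path-≤ π)) (proj₂ (path-≤ π)) (λ e → ℕₚ.1+n≢n (proj₁ e)))
  (after-null x c π (λ r t r<t k<r l≤t r≤ t≤ _ → null r t r<t (ℕₚ.<⇒≤ k<r) l≤t r≤ t≤ (λ e → ℕₚ.<⇒≢ k<r (sym (proj₁ e)))))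
after-null x {k} {l} k<l (up π) null = cong₂ _+_
  (null k (suc l) k<1+l ℕₚ.≤-refl (ℕₚ.n≤1+n l) (proj₁ (path-≤ π)) (proj₂ (path-≤ π)) (λ e → ℕₚ.1+n≢n (proj₂ e)))
  (after-null x k<1+l π (λ r t r<t k≤r l<t r≤ t≤ _ → null r t r<t k≤r (ℕₚ.<⇒≤ l<t) r≤ t≤ (λ e → ℕₚ.<⇒≢ l<t (sym (proj₂ e)))))
  where
  k<1+l : k < suc l
  k<1+l = ℕₚ.m≤n⇒m≤1+n k<l

total-end : ∀ x {k l k′ l′} → k < l → (π : Path k l k′ l′) →
  (∀ r t → r < t → k ≤ r → l ≤ t → r ≤ k′ → t ≤ l′ → ¬ (r ≡ k′ × t ≡ l′) → x r t ≡ 0ℚ) → total x π ≡ x k′ l′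
total-end x {k} {l} k<l stop null = ℚₚ.+-identityʳ (x k l)
total-end x {k} {l} {k′} {l′} k<l (right c π) null = trans (cong₂ _+_
  (null k l k<l ℕₚ.≤-refl ℕₚ.≤-refl (ℕₚ.<⇒≤ (proj₁ (path-≤ π))) (proj₂ (path-≤ π)) (λ e → ℕₚ.<⇒≢ (proj₁ (path-≤ π)) (proj₁ e)))
  (total-end x c π (λ r t r<t k<r → null r t r<t (ℕₚ.<⇒≤ k<r)))) (ℚₚ.+-identityˡ (x k′ l′))
total-end x {k} {l} {k′} {l′} k<l (up π) null = trans (cong₂ _+_
  (null k l k<l ℕₚ.≤-refl ℕₚ.≤-refl (proj₁ (path-≤ π)) (ℕₚ.<⇒≤ (proj₂ (path-≤ π))) (λ e → ℕₚ.<⇒≢ (proj₂ (path-≤ π)) (proj₂ e)))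
  (total-end x (ℕₚ.m≤n⇒m≤1+n k<l) π (λ r t r<t k≤r l<t → null r t r<t k≤r (ℕₚ.<⇒≤ l<t)))) (ℚₚ.+-identityˡ (x k′ l′))

after-end : ∀ x {k l k′ l′} → k < l → (π : Path k l k′ l′) → ¬ (k ≡ k′ × l ≡ l′) →
  (∀ r t → r < t → k ≤ r → l ≤ t → r ≤ k′ → t ≤ l′ → ¬ (r ≡ k × t ≡ l) → ¬ (r ≡ k′ × t ≡ l′) → x r t ≡ 0ℚ) →
  after x π ≡ x k′ l′
after-end x k<l stop        ≢end null = ⊥-elim (≢end (refl , refl))
after-end x k<l (right c π) ≢end null = total-end x c π
  (λ r t r<t k<r l≤t r≤ t≤ → null r t r<t (ℕₚ.<⇒≤ k<r) l≤t r≤ t≤ (λ e → ℕₚ.<⇒≢ k<r (sym (proj₁ e))))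
after-end x k<l (up π)      ≢end null = total-end x (ℕₚ.m≤n⇒m≤1+n k<l) π
  (λ r t r<t k≤r l<t r≤ t≤ → null r t r<t k≤r (ℕₚ.<⇒≤ l<t) r≤ t≤ (λ e → ℕₚ.<⇒≢ l<t (sym (proj₂ e))))

total-+ : ∀ x y {k l k′ l′} (π : Path k l k′ l′) → total (x +ₚ y) π ≡ total x π + total y π
total-+ x y {k} {l} stop        = +-interchange (x k l) (y k l) 0ℚ 0ℚ
total-+ x y {k} {l} (right _ π) = trans (cong ((x k l + y k l) +_) (total-+ x y π)) (+-interchange (x k l) (y k l) (total x π) (total y π))
total-+ x y {k} {l} (up π)      = trans (cong ((x k l + y k l) +_) (total-+ x y π)) (+-interchange (x k l) (y k l) (total x π) (total y π))

total-· : ∀ c x {k l k′ l′} (π : Path k l k′ l′) → total (c ·ₚ x) π ≡ c * total x π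
total-· c x {k} {l} stop        = trans (cong ((c * x k l) +_) (sym (ℚₚ.*-zeroʳ c))) (sym (ℚₚ.*-distribˡ-+ c (x k l) 0ℚ))
total-· c x {k} {l} (right _ π) = trans (cong ((c * x k l) +_) (total-· c x π)) (sym (ℚₚ.*-distribˡ-+ c (x k l) (total x π)))
total-· c x {k} {l} (up π)      = trans (cong ((c * x k l) +_) (total-· c x π)) (sym (ℚₚ.*-distribˡ-+ c (x k l) (total x π)))

total-sum : ∀ m (w : ℕ → Pt) {k l k′ l′} (π : Path k l k′ l′) →
            total (λ r t → sumℚ m (λ s → w s r t)) π ≡ sumℚ m (λ s → total (w s) π)
total-sum m w {k} {l} stop        = trans (ℚₚ.+-identityʳ _) (sumℚ-cong m (λ s _ → sym (ℚₚ.+-identityʳ (w s k l))))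
total-sum m w {k} {l} (right _ π) = trans (cong (sumℚ m (λ s → w s k l) +_) (total-sum m w π)) (sym (sumℚ-+ m (λ s → w s k l) (λ s → total (w s) π)))
total-sum m w {k} {l} (up π)      = trans (cong (sumℚ m (λ s → w s k l) +_) (total-sum m w π)) (sym (sumℚ-+ m (λ s → w s k l) (λ s → total (w s) π)))

module _ {n : ℕ} where

  total-mono : ∀ x y {k l k′ l′} → 1 ≤ k → k < l → l′ ≤ n → (π : Path k l k′ l′) →
               (∀ r t → InTri n r t → x r t ℚ.≤ y r t) → total x π ℚ.≤ total y π
  total-mono x y {k} {l} 1≤k k<l l′≤n stop le = ℚₚ.+-monoˡ-≤ 0ℚ (le k l (1≤k , k<l , l′≤n))
  total-mono x y {k} {l} 1≤k k<l l′≤n (right c π) le =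
    ℚₚ.+-mono-≤ (le k l (1≤k , k<l , ℕₚ.≤-trans (proj₂ (path-≤ π)) l′≤n))
                (total-mono x y (s≤s z≤n) c l′≤n π le)
  total-mono x y {k} {l} 1≤k k<l l′≤n (up π) le =
    ℚₚ.+-mono-≤ (le k l (1≤k , k<l , ℕₚ.≤-trans (ℕₚ.<⇒≤ (proj₂ (path-≤ π))) l′≤n))
                (total-mono x y 1≤k (ℕₚ.m≤n⇒m≤1+n k<l) l′≤n π le)

  total-cong : ∀ x y {k l k′ l′} → 1 ≤ k → k < l → l′ ≤ n → (π : Path k l k′ l′) →
               (∀ r t → InTri n r t → x r t ≡ y r t) → total x π ≡ total y π
  total-cong x y 1≤k k<l l′≤n π eq = ℚₚ.≤-antisym
    (total-mono x y 1≤k k<l l′≤n π (λ r t v → ℚₚ.≤-reflexive (eq r t v)))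
    (total-mono y x 1≤k k<l l′≤n π (λ r t v → ℚₚ.≤-reflexive (sym (eq r t v))))

-- Points on a path and sums of nonnegative coordinates

data On (r t : ℕ) : ∀ {k l k′ l′} → Path k l k′ l′ → Set where
  here  : ∀ {k′ l′} {π : Path r t k′ l′} → On r t π
  right : ∀ {k l k′ l′} {c : suc k < l} {π : Path (suc k) l k′ l′} → On r t π → On r t (right c π)
  up    : ∀ {k l k′ l′} {π : Path k (suc l) k′ l′} → On r t π → On r t (up π)

On-end : ∀ {k l k′ l′} (π : Path k l k′ l′) → On k′ l′ π
On-end stop        = here
On-end (right c π) = right (On-end π)
On-end (up π)      = up (On-end π)

On-++ˡ : ∀ {r t k l k′ l′ k″ l″} {π : Path k l k′ l′} (ρ : Path k′ l′ k″ l″) → On r t π → On r t (π ++ₚ ρ)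
On-++ˡ ρ here      = here
On-++ˡ ρ (right o) = right (On-++ˡ ρ o)
On-++ˡ ρ (up o)    = up (On-++ˡ ρ o)

On-++ʳ : ∀ {r t k l k′ l′ k″ l″} (π : Path k l k′ l′) {ρ : Path k′ l′ k″ l″} → On r t ρ → On r t (π ++ₚ ρ)
On-++ʳ stop        o = o
On-++ʳ (right c π) o = right (On-++ʳ π o)
On-++ʳ (up π)      o = up (On-++ʳ π o)

On-≥start : ∀ {r t k l k′ l′} {π : Path k l k′ l′} → On r t π → k ≤ r × l ≤ t
On-≥start here      = ℕₚ.≤-refl , ℕₚ.≤-refl
On-≥start (right o) = let p , q = On-≥start o in ℕₚ.<⇒≤ p , q
On-≥start (up o)    = let p , q = On-≥start o in p , ℕₚ.<⇒≤ q

On-≤end : ∀ {r t k l k′ l′} {π : Path k l k′ l′} → On r t π → r ≤ k′ × t ≤ l′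
On-≤end {π = π} here = path-≤ π
On-≤end (right o)    = On-≤end o
On-≤end (up o)       = On-≤end o

≤-+ˡ : ∀ {p q r} → 0ℚ ℚ.≤ p → r ℚ.≤ q → r ℚ.≤ p + q
≤-+ˡ {r = r} 0≤p r≤q = ℚₚ.≤-trans (ℚₚ.≤-reflexive (sym (ℚₚ.+-identityˡ r))) (ℚₚ.+-mono-≤ 0≤p r≤q)

≤-+ʳ : ∀ {p q r} → r ℚ.≤ p → 0ℚ ℚ.≤ q → r ℚ.≤ p + q
≤-+ʳ {r = r} r≤p 0≤q = ℚₚ.≤-trans (ℚₚ.≤-reflexive (sym (ℚₚ.+-identityʳ r))) (ℚₚ.+-mono-≤ r≤p 0≤q)

module _ {n : ℕ} (x : Pt) (nonneg : ∀ r t → InTri n r t → 0ℚ ℚ.≤ x r t) where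



  total-nonneg : ∀ {k l k′ l′} → 1 ≤ k → k < l → l′ ≤ n → (π : Path k l k′ l′) → 0ℚ ℚ.≤ total x π
  total-nonneg {k} {l} 1≤k k<l l′≤n stop        = ≤-+ʳ (nonneg k l (1≤k , k<l , l′≤n)) ℚₚ.≤-refl
  total-nonneg {k} {l} 1≤k k<l l′≤n (right c π) =
    ≤-+ˡ (nonneg k l (1≤k , k<l , ℕₚ.≤-trans (proj₂ (path-≤ π)) l′≤n)) (total-nonneg (s≤s z≤n) c l′≤n π)
  total-nonneg {k} {l} 1≤k k<l l′≤n (up π)      =
    ≤-+ˡ (nonneg k l (1≤k , k<l , ℕₚ.≤-trans (ℕₚ.<⇒≤ (proj₂ (path-≤ π))) l′≤n))
         (total-nonneg 1≤k (ℕₚ.m≤n⇒m≤1+n k<l) l′≤n π)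

  after-nonneg : ∀ {k l k′ l′} → 1 ≤ k → k < l → l′ ≤ n → (π : Path k l k′ l′) → 0ℚ ℚ.≤ after x π
  after-nonneg 1≤k k<l l′≤n stop        = ℚₚ.≤-refl
  after-nonneg 1≤k k<l l′≤n (right c π) = total-nonneg (s≤s z≤n) c l′≤n π
  after-nonneg 1≤k k<l l′≤n (up π)      = total-nonneg 1≤k (ℕₚ.m≤n⇒m≤1+n k<l) l′≤n π

  total-≥ : ∀ {r t k l k′ l′} → 1 ≤ k → k < l → l′ ≤ n → {π : Path k l k′ l′} → On r t π →
            x r t ℚ.≤ total x π
  total-≥ 1≤k k<l l′≤n {π} here = ≤-+ʳ ℚₚ.≤-refl (after-nonneg 1≤k k<l l′≤n π)
  total-≥ {k = k} {l} 1≤k k<l l′≤n {right c π} (right o) =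
    ≤-+ˡ (nonneg k l (1≤k , k<l , ℕₚ.≤-trans (proj₂ (path-≤ π)) l′≤n)) (total-≥ (s≤s z≤n) c l′≤n o)
  total-≥ {k = k} {l} 1≤k k<l l′≤n {up π} (up o) =
    ≤-+ˡ (nonneg k l (1≤k , k<l , ℕₚ.≤-trans (ℕₚ.<⇒≤ (proj₂ (path-≤ π))) l′≤n))
         (total-≥ 1≤k (ℕₚ.m≤n⇒m≤1+n k<l) l′≤n o)

  after-≥end : ∀ {k l k′ l′} → 1 ≤ k → k < l → l′ ≤ n → (π : Path k l k′ l′) → ¬ (k ≡ k′ × l ≡ l′) →
               x k′ l′ ℚ.≤ after x π
  after-≥end 1≤k k<l l′≤n stop        ≢end = ⊥-elim (≢end (refl , refl))
  after-≥end 1≤k k<l l′≤n (right c π) ≢end = total-≥ (s≤s z≤n) c l′≤n (On-end π)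
  after-≥end 1≤k k<l l′≤n (up π)      ≢end = total-≥ 1≤k (ℕₚ.m≤n⇒m≤1+n k<l) l′≤n (On-end π)

-- Antichains

record Antichain (n i : ℕ) (A : ℕ → ℕ → Bool) : Set where
  field
    inside : ∀ {k l} → A k l ≡ true → (1 ≤ k × k ≤ i) × (i < l × l ≤ n)
    anti   : ∀ {k l k′ l′} → A k l ≡ true → A k′ l′ ≡ true → k ≤ k′ → l ≤ l′ → k ≡ k′ × l ≡ l′

  inTri : ∀ {k l} → A k l ≡ true → InTri n k l
  inTri p with inside p
  ... | (1≤k , k≤i) , (i<l , l≤n) = 1≤k , ℕₚ.≤-<-trans k≤i i<l , l≤n

open Antichain

χ : Bool → ℚ
χ true  = 1ℚ
χ false = 0ℚ

𝟙 : (ℕ → ℕ → Bool) → Pt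
𝟙 A k l = χ (A k l)

0≤1 : 0ℚ ℚ.≤ 1ℚ
0≤1 = ℚₚ.nonNegative⁻¹ 1ℚ

χ-nonneg : ∀ b → 0ℚ ℚ.≤ χ b
χ-nonneg true  = 0≤1
χ-nonneg false = ℚₚ.≤-refl

≢true : ∀ {b} → ¬ b ≡ true → b ≡ false
≢true {true}  b≢ = contradiction refl b≢
≢true {false} b≢ = refl

module _ {n i : ℕ} {A : ℕ → ℕ → Bool} (ac : Antichain n i A) where

  -- A path is a chain, so it meets an antichain at most once: after a hit every later point is
  -- comparable to it and contributes 0.
  total-𝟙≤1 : ∀ {k l k′ l′} → k < l → (π : Path k l k′ l′) → total (𝟙 A) π ℚ.≤ 1ℚ
  total-𝟙≤1 {k} {l} k<l π with A k l in eq
  ... | true = ℚₚ.≤-reflexive (trans (cong (1ℚ +_) (after-null (𝟙 A) k<l π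
          (λ r t _ k≤r l≤t _ _ ≢start → cong χ (≢true (λ p →
            let e , e′ = anti ac eq p k≤r l≤t in ≢start (sym e , sym e′)))))) (ℚₚ.+-identityʳ 1ℚ))
  total-𝟙≤1 k<l stop        | false = 0≤1
  total-𝟙≤1 k<l (right c π) | false =
    ℚₚ.≤-trans (ℚₚ.≤-reflexive (ℚₚ.+-identityˡ (total (𝟙 A) π))) (total-𝟙≤1 c π)
  total-𝟙≤1 k<l (up π)      | false =
    ℚₚ.≤-trans (ℚₚ.≤-reflexive (ℚₚ.+-identityˡ (total (𝟙 A) π))) (total-𝟙≤1 (ℕₚ.m≤n⇒m≤1+n k<l) π)

  -- Coordinates grow along a path, so if `i` is outside its range, all its points have first
  -- coordinate above `i` or all have second coordinate at most `i`. Either way they miss the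
  -- rectangle of `A`.
  total-𝟙≡0 : ∀ {j j′} (π : DyckPath j j′) → i < j ⊎ j′ < i → total (𝟙 A) π ≡ 0ℚ
  total-𝟙≡0 {j} {j′} π out = cong₂ _+_
    (null j (suc j) ℕₚ.≤-refl (proj₂ (path-≤ π)))
    (after-null (𝟙 A) ℕₚ.≤-refl π (λ r t _ j≤r _ _ t≤ _ → null r t j≤r t≤))
    where
    null : ∀ r t → j ≤ r → t ≤ suc j′ → 𝟙 A r t ≡ 0ℚ
    null r t j≤r t≤ = cong χ (≢true (absurd out))
      where
      absurd : i < j ⊎ j′ < i → ¬ A r t ≡ true
      absurd (inj₁ i<j)  p = ℕₚ.<⇒≱ i<j (ℕₚ.≤-trans j≤r (proj₂ (proj₁ (inside ac p))))
      absurd (inj₂ j′<i) p = ℕₚ.<⇒≱ (proj₁ (proj₂ (inside ac p))) (ℕₚ.≤-trans t≤ j′<i)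

*-monoˡ-nonneg : ∀ c {p q} → 0ℚ ℚ.≤ c → p ℚ.≤ q → c * p ℚ.≤ c * q
*-monoˡ-nonneg c 0≤c p≤q = ℚₚ.*-monoˡ-≤-nonNeg c {{ℚ.nonNegative 0≤c}} p≤q

-- Two antichains appear because an exchange will move only one of the `suc c` copies. A path meets
-- each at most once, which gives at most `c + 1` if `i` is in its range, and 0 otherwise.
antichains-FFLV : ∀ {n i A A′} c → Antichain n i A → Antichain n i A′ →
                  FFLV n (single i (suc c)) ((toℚ c ·ₚ 𝟙 A) +ₚ 𝟙 A′)
antichains-FFLV {n} {i} {A} {A′} c ac ac′ = path-FFLV n (single i (suc c)) ((toℚ c ·ₚ 𝟙 A) +ₚ 𝟙 A′) nonneg bound
  where
  C : ℚ
  C = toℚ c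

  nonneg : ∀ k l → InTri n k l → 0ℚ ℚ.≤ C * 𝟙 A k l + 𝟙 A′ k l
  nonneg k l _ = ℚₚ.≤-trans (ℚₚ.≤-reflexive (cong (_+ 0ℚ) (sym (ℚₚ.*-zeroʳ C))))
    (ℚₚ.+-mono-≤ (*-monoˡ-nonneg C (toℚ-nonneg c) (χ-nonneg (A k l))) (χ-nonneg (A′ k l)))

  total≡ : ∀ {k l k′ l′} (π : Path k l k′ l′) →
           total ((C ·ₚ 𝟙 A) +ₚ 𝟙 A′) π ≡ C * total (𝟙 A) π + total (𝟙 A′) π
  total≡ π = trans (total-+ (C ·ₚ 𝟙 A) (𝟙 A′) π) (cong (_+ total (𝟙 A′) π) (total-· C (𝟙 A) π))

  C+1 : C * 1ℚ + 1ℚ ≡ toℚ (suc c)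
  C+1 = trans (cong (_+ 1ℚ) (ℚₚ.*-identityʳ C)) (trans (ℚₚ.+-comm C 1ℚ) (sym (trans (toℚ-+ 1 c) (cong (_+ toℚ c) toℚ-1))))

  bound : ∀ {j j′} → 1 ≤ j → j′ < n → (π : DyckPath j j′) →
          total ((C ·ₚ 𝟙 A) +ₚ 𝟙 A′) π ℚ.≤ toℚ (rangeSum (single i (suc c)) j j′)
  bound {j} {j′} _ _ π = ℚₚ.≤-trans (ℚₚ.≤-reflexive (total≡ π)) (by (in-or-out i j j′))
    where
    by : (j ≤ i × i ≤ j′) ⊎ (i < j ⊎ j′ < i) →
         C * total (𝟙 A) π + total (𝟙 A′) π ℚ.≤ toℚ (rangeSum (single i (suc c)) j j′)
    by (inj₁ (p , q)) = ℚₚ.≤-trans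
      (ℚₚ.+-mono-≤ (*-monoˡ-nonneg C (toℚ-nonneg c) (total-𝟙≤1 ac ℕₚ.≤-refl π)) (total-𝟙≤1 ac′ ℕₚ.≤-refl π))
      (ℚₚ.≤-reflexive (trans C+1 (sym (weight-in i (suc c) j j′ p q))))
    by (inj₂ out) = ℚₚ.≤-reflexive (trans
      (cong₂ (λ p q → C * p + q) (total-𝟙≡0 ac π out) (total-𝟙≡0 ac′ π out))
      (trans (cong (_+ 0ℚ) (ℚₚ.*-zeroʳ C)) (sym (weight-out i (suc c) j j′ out))))

-- Vertices of P_{aω}

p-0≡p : ∀ p → p - 0ℚ ≡ p
p-0≡p = solve 1 (λ p → p :- con 0ℚ := p) refl where open +-*-Solver

p-p≡0 : ∀ p → p - p ≡ 0ℚ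
p-p≡0 = ℚₚ.+-inverseʳ

p+q-q : ∀ p q → (p + q) - q ≡ p
p+q-q = solve 2 (λ p q → (p :+ q) :- q := p) refl where open +-*-Solver

[p-q]+[r-s] : ∀ p q r s → (p - q) + (r - s) ≡ (p + r) - (q + s)
[p-q]+[r-s] = solve 4 (λ p q r s → (p :- q) :+ (r :- s) := (p :+ r) :- (q :+ s)) refl
  where open +-*-Solver

halve : ∀ p → p ≡ ½ * (p + p)
halve = solve 1 (λ p → p := con ½ :* (p :+ p)) refl where open +-*-Solver

½<1 : ½ ℚ.< 1ℚ
½<1 = ℚ.*<* (ℤ.+<+ (s≤s (s≤s z≤n)))

double-injective : ∀ p q → p + p ≡ q + q → p ≡ q
double-injective p q eq = trans (halve p) (trans (cong (½ *_) eq) (sym (halve q)))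

0≤q-p : ∀ {p q} → p ℚ.≤ q → 0ℚ ℚ.≤ q - p
0≤q-p {p} {q} p≤q = ℚₚ.≤-trans (ℚₚ.≤-reflexive (sym (p-p≡0 p))) (ℚₚ.+-monoˡ-≤ (- p) p≤q)

-- φ k l is the largest sum of x over a path ending at (k , l), and prev k l the largest over
-- such paths without their last point.
module Percolation (x : Pt) where

  abstract
    φ : ℕ → ℕ → ℚ
    -- The value 0 outside the triangle lets `prev` be a plain maximum at the border too.
    φ zero    _       = 0ℚ
    φ (suc k) zero    = 0ℚ
    φ (suc k) (suc l) = if does (k ℕ.<? l) then x (suc k) (suc l) + (φ k (suc l) ⊔ φ (suc k) l) else 0ℚ

    φ-zero : ∀ l → φ 0 l ≡ 0ℚ
    φ-zero l = refl

  prev : ℕ → ℕ → ℚ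
  prev k l = φ (k ∸ 1) l ⊔ φ k (l ∸ 1)

  abstract
    φ-step : ∀ k l → 1 ≤ k → k < l → φ k l ≡ x k l + prev k l
    φ-step (suc k) (suc l) _ (s≤s k<l) = cong (λ b → if b then x (suc k) (suc l) + prev (suc k) (suc l) else 0ℚ) (dec-true (k ℕ.<? l) k<l)

    φ-outside : ∀ k l → l ≤ k → φ k l ≡ 0ℚ
    φ-outside zero    _       _         = refl
    φ-outside (suc k) zero    _         = refl
    φ-outside (suc k) (suc l) (s≤s l≤k) = cong (λ b → if b then x (suc k) (suc l) + prev (suc k) (suc l) else 0ℚ) (dec-false (k ℕ.<? l) (ℕₚ.≤⇒≯ l≤k))

module Vertex (n i c : ℕ) (0<c : 0 < c) (x : Pt) (vertex : IsVertex n (FFLV n (single i c)) x) where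

  open Percolation x

  C : ℚ
  C = toℚ c

  0<C : 0ℚ ℚ.< C
  0<C = toℚ-pos 0<c

  0≤C : 0ℚ ℚ.≤ C
  0≤C = ℚₚ.<⇒≤ 0<C

  C≢0 : ¬ C ≡ 0ℚ
  C≢0 eq = ℚₚ.<⇒≢ 0<C (sym eq)

  x-nonneg : ∀ k l → InTri n k l → 0ℚ ℚ.≤ x k l
  x-nonneg k l (p , q , r) = proj₁ (proj₁ vertex) k l p q r

  x-bound : ∀ {j j′} → 1 ≤ j → j′ < n → (π : DyckPath j j′) → total x π ℚ.≤ toℚ (rangeSum (single i c) j j′)
  x-bound = FFLV-path n (single i c) x (proj₁ vertex)

  φ-nonneg : ∀ k l → l ≤ n → 0ℚ ℚ.≤ φ k l
  φ-nonneg zero    l       l≤n = ℚₚ.≤-reflexive (sym (φ-zero l))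
  φ-nonneg (suc k) zero    l≤n = ℚₚ.≤-reflexive (sym (φ-outside (suc k) 0 z≤n))
  φ-nonneg (suc k) (suc l) l≤n = by (ℕₚ.≤-<-connex l k)
    where
    by : l ≤ k ⊎ k < l → 0ℚ ℚ.≤ φ (suc k) (suc l)
    by (inj₁ l≤k) = ℚₚ.≤-reflexive (sym (φ-outside (suc k) (suc l) (s≤s l≤k)))
    by (inj₂ k<l) = ℚₚ.≤-trans
      (≤-+ʳ (x-nonneg (suc k) (suc l) (s≤s z≤n , s≤s k<l , l≤n))
        (ℚₚ.≤-trans (φ-nonneg k (suc l) l≤n) (ℚₚ.p≤p⊔q (φ k (suc l)) (φ (suc k) l))))
      (ℚₚ.≤-reflexive (sym (φ-step (suc k) (suc l) (s≤s z≤n) (s≤s k<l))))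

  prev-nonneg : ∀ k l → l ≤ n → 0ℚ ℚ.≤ prev k l
  prev-nonneg k l l≤n = ℚₚ.≤-trans (φ-nonneg (k ∸ 1) l l≤n) (ℚₚ.p≤p⊔q (φ (k ∸ 1) l) (φ k (l ∸ 1)))

  prev≤φ : ∀ k l → InTri n k l → prev k l ℚ.≤ φ k l
  prev≤φ k l tri@(1≤k , k<l , _) = ℚₚ.≤-trans (≤-+ˡ (x-nonneg k l tri) ℚₚ.≤-refl)
    (ℚₚ.≤-reflexive (sym (φ-step k l 1≤k k<l)))

  -- The recursion walks backwards: the maximum in `prev` is attained at one of the two
  -- predecessors, and the current point is handed over from `φ` to the path. It stops next to the
  -- diagonal, where the path has become a full Dyck path.
  φ-after : ∀ k l → InTri n k l → ∀ {j} → j < n → (π : Path k l j (suc j)) → φ k l + after x π ℚ.≤ C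
  φ-after (suc k) (suc l) (1≤k , s≤s k<l , l≤n) {j} j<n π = ℚₚ.≤-trans
      (ℚₚ.≤-reflexive (trans (cong (_+ after x π) (φ-step (suc k) (suc l) 1≤k (s≤s k<l)))
        (regroup (x (suc k) (suc l)) (prev (suc k) (suc l)) (after x π))))
      (either (ℚₚ.⊔-sel (φ k (suc l)) (φ (suc k) l)))
    where
    regroup : ∀ p q r → (p + q) + r ≡ q + (p + r)
    regroup = solve 3 (λ p q r → (p :+ q) :+ r := q :+ (p :+ r)) refl where open +-*-Solver

    below : φ (suc k) l + total x π ℚ.≤ C
    below = by (ℕₚ.m≤n⇒m<n∨m≡n k<l) π
      where
      by : suc k < l ⊎ suc k ≡ l → (π : Path (suc k) (suc l) j (suc j)) → φ (suc k) l + total x π ℚ.≤ C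
      by (inj₁ k+1<l) π = φ-after (suc k) l (1≤k , k+1<l , ℕₚ.<⇒≤ l≤n) j<n (up π)
      by (inj₂ refl)  π = ℚₚ.≤-trans
        (ℚₚ.≤-reflexive (trans (cong (_+ total x π) (φ-outside (suc k) (suc k) ℕₚ.≤-refl)) (ℚₚ.+-identityˡ (total x π))))
        (ℚₚ.≤-trans (x-bound 1≤k j<n π) (weight-≤ i c (suc k) j))

    left : ∀ k₀ → k₀ ≡ k → φ k₀ (suc l) + total x π ℚ.≤ C
    -- There is no predecessor in column 0. Its default value 0 is at most `φ 1 l`, so the other
    -- predecessor covers this case.
    left zero     refl = ℚₚ.≤-trans (ℚₚ.+-monoˡ-≤ (total x π) (ℚₚ.≤-trans (ℚₚ.≤-reflexive (φ-zero (suc l))) (φ-nonneg 1 l (ℕₚ.<⇒≤ l≤n)))) below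
    left (suc k₀) refl = φ-after k (suc l) (s≤s z≤n , ℕₚ.m≤n⇒m≤1+n k<l , l≤n) j<n (right (s≤s k<l) π)

    either : prev (suc k) (suc l) ≡ φ k (suc l) ⊎ prev (suc k) (suc l) ≡ φ (suc k) l →
             prev (suc k) (suc l) + total x π ℚ.≤ C
    either (inj₁ e) = ℚₚ.≤-trans (ℚₚ.≤-reflexive (cong (_+ total x π) e)) (left k refl)
    either (inj₂ e) = ℚₚ.≤-trans (ℚₚ.≤-reflexive (cong (_+ total x π) e)) below

  φ≤C : ∀ k l → InTri n k l → φ k l ℚ.≤ C
  φ≤C k (suc l) tri@(1≤k , s≤s k≤l , l≤n) = ℚₚ.≤-trans
    (≤-+ʳ ℚₚ.≤-refl (after-nonneg x x-nonneg 1≤k (s≤s k≤l) l≤n π))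
    (φ-after k (suc l) tri l≤n π)
    where
    π : Path k (suc l) l (suc l)
    π = horizontal k≤l ℕₚ.≤-refl

  -- For the identity this is `x` inside the triangle. Two functions `g` and `g′` that add up to
  -- twice the identity therefore split `x + x`.
  cut : (ℚ → ℚ) → Pt
  cut g k l = g (φ k l) - g (prev k l)

  Mono : (ℚ → ℚ) → Set
  Mono g = ∀ {p q} → p ℚ.≤ q → g p ℚ.≤ g q

  cut-sum : ∀ g g′ → (∀ q → g q + g′ q ≡ q + q) → ∀ k l → InTri n k l → cut g k l + cut g′ k l ≡ x k l + x k l
  cut-sum g g′ g+g′ k l (1≤k , k<l , _) = trans
    ([p-q]+[r-s] (g (φ k l)) (g (prev k l)) (g′ (φ k l)) (g′ (prev k l)))
    (trans (cong₂ _-_ (trans (g+g′ (φ k l)) (cong (λ q → q + q) (φ-step k l 1≤k k<l))) (g+g′ (prev k l)))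
      (cancel (x k l) (prev k l)))
    where
    cancel : ∀ p q → ((p + q) + (p + q)) - (q + q) ≡ p + p
    cancel = solve 2 (λ p q → ((p :+ q) :+ (p :+ q)) :- (q :+ q) := p :+ p) refl where open +-*-Solver

  cut-nonneg : ∀ g → Mono g → ∀ k l → InTri n k l → 0ℚ ℚ.≤ cut g k l
  cut-nonneg g mono k l tri = 0≤q-p (mono (prev≤φ k l tri))

  telescope : ∀ p q r → (p - q) + (r - p) ≡ r - q
  telescope = solve 3 (λ p q r → (p :- q) :+ (r :- p) := r :- q) refl where open +-*-Solver

  -- prev at the head of a step dominates φ at its tail, so the sum telescopes.
  after-cut : ∀ g → Mono g → ∀ {k l k′ l′} (π : Path k l k′ l′) → after (cut g) π ℚ.≤ g (φ k′ l′) - g (φ k l)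
  after-cut g mono {k} {l} stop = ℚₚ.≤-reflexive (sym (p-p≡0 (g (φ k l))))
  after-cut g mono {k} {l} {k′} {l′} (right _ π) = ℚₚ.≤-trans
    (ℚₚ.+-mono-≤ (ℚₚ.+-monoʳ-≤ (g (φ (suc k) l)) (ℚₚ.neg-antimono-≤ (mono (ℚₚ.p≤p⊔q (φ k l) (φ (suc k) (l ∸ 1))))))
      (after-cut g mono π))
    (ℚₚ.≤-reflexive (telescope (g (φ (suc k) l)) (g (φ k l)) (g (φ k′ l′))))
  after-cut g mono {k} {l} {k′} {l′} (up π) = ℚₚ.≤-trans
    (ℚₚ.+-mono-≤ (ℚₚ.+-monoʳ-≤ (g (φ k (suc l))) (ℚₚ.neg-antimono-≤ (mono (ℚₚ.p≤q⊔p (φ (k ∸ 1) (suc l)) (φ k l)))))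
      (after-cut g mono π))
    (ℚₚ.≤-reflexive (telescope (g (φ k (suc l))) (g (φ k l)) (g (φ k′ l′))))

  total-cut : ∀ g → Mono g → g 0ℚ ≡ 0ℚ → ∀ {k l k′ l′} → l ≤ n → (π : Path k l k′ l′) →
              total (cut g) π ℚ.≤ g (φ k′ l′)
  total-cut g mono g0 {k} {l} {k′} {l′} l≤n π = ℚₚ.≤-trans
    (ℚₚ.+-monoʳ-≤ (cut g k l) (after-cut g mono π))
    (ℚₚ.≤-trans (ℚₚ.≤-reflexive (telescope (g (φ k l)) (g (prev k l)) (g (φ k′ l′))))
      (ℚₚ.≤-trans (ℚₚ.+-monoʳ-≤ (g (φ k′ l′)) (ℚₚ.neg-antimono-≤
          (ℚₚ.≤-trans (ℚₚ.≤-reflexive (sym g0)) (mono (prev-nonneg k l l≤n)))))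
        (ℚₚ.≤-reflexive (p-0≡p (g (φ k′ l′))))))

  -- If `i` is in the range of the path, telescoping bounds the sum by the value of `g` at the last
  -- `φ`, which is at most `C`. Otherwise the bound has to be 0, and `g′` provides it: the cut is at
  -- most `x +ₚ x`, whose sum is at most 0 on such a path.
  cut-FFLV : ∀ g g′ → Mono g → Mono g′ → (∀ q → g q + g′ q ≡ q + q) → g 0ℚ ≡ 0ℚ →
             (∀ q → q ℚ.≤ C → g q ℚ.≤ C) → FFLV n (single i c) (cut g)
  cut-FFLV g g′ mono mono′ g+g′ g0 g≤C = path-FFLV n (single i c) (cut g) (cut-nonneg g mono) bound
    where
    cut≤2x : ∀ k l → InTri n k l → cut g k l ℚ.≤ (x +ₚ x) k l
    cut≤2x k l tri = ℚₚ.≤-trans (≤-+ʳ ℚₚ.≤-refl (cut-nonneg g′ mono′ k l tri))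
                                (ℚₚ.≤-reflexive (cut-sum g g′ g+g′ k l tri))

    bound : ∀ {j j′} → 1 ≤ j → j′ < n → (π : DyckPath j j′) →
            total (cut g) π ℚ.≤ toℚ (rangeSum (single i c) j j′)
    bound {j} {j′} 1≤j j′<n π = by (in-or-out i j j′)
      where
      W : ℚ
      W = toℚ (rangeSum (single i c) j j′)

      by : (j ≤ i × i ≤ j′) ⊎ (i < j ⊎ j′ < i) → total (cut g) π ℚ.≤ W
      by (inj₁ (p , q)) = ℚₚ.≤-trans (total-cut g mono g0 (ℕₚ.≤-trans (proj₂ (path-≤ π)) j′<n) π)
        (ℚₚ.≤-trans (g≤C (φ j′ (suc j′)) (φ≤C j′ (suc j′) (ℕₚ.≤-trans 1≤j (proj₁ (path-≤ π)) , ℕₚ.≤-refl , j′<n)))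
          (ℚₚ.≤-reflexive {C} {W} (sym (weight-in i c j j′ p q))))
      by (inj₂ out) = ℚₚ.≤-trans (total-mono (cut g) (x +ₚ x) 1≤j ℕₚ.≤-refl j′<n π cut≤2x)
        (ℚₚ.≤-trans (ℚₚ.≤-reflexive (total-+ x x π))
          (ℚₚ.≤-trans (ℚₚ.+-mono-≤ x≤0 x≤0) (ℚₚ.≤-reflexive {0ℚ} {W} (sym (weight-out i c j j′ out)))))
        where
        x≤0 : total x π ℚ.≤ 0ℚ
        x≤0 = ℚₚ.≤-trans {total x π} {W} (x-bound 1≤j j′<n π) (ℚₚ.≤-reflexive {W} {0ℚ} (weight-out i c j j′ out))

  -- The threshold C / 2 cuts x into the halves of two points of the polytope.
  lower upper : ℚ → ℚ
  lower q = (q + q) ⊓ C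
  upper q = ((q + q) - C) ⊔ 0ℚ

  lower-mono : Mono lower
  lower-mono p≤q = ℚₚ.⊓-mono-≤ (ℚₚ.+-mono-≤ p≤q p≤q) (ℚₚ.≤-refl {C})

  upper-mono : Mono upper
  upper-mono p≤q = ℚₚ.⊔-mono-≤ (ℚₚ.+-monoˡ-≤ (- C) (ℚₚ.+-mono-≤ p≤q p≤q)) (ℚₚ.≤-refl {0ℚ})

  q-C≤0 : ∀ {q} → q ℚ.≤ C → q - C ℚ.≤ 0ℚ
  q-C≤0 {q} q≤C = ℚₚ.≤-trans (ℚₚ.+-monoˡ-≤ (- C) q≤C) (ℚₚ.≤-reflexive (p-p≡0 C))

  small : ∀ q → q + q ℚ.≤ C → lower q ≡ q + q × upper q ≡ 0ℚ
  small q h = ℚₚ.p≤q⇒p⊓q≡p h , ℚₚ.p≤q⇒p⊔q≡q (q-C≤0 h)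

  large : ∀ q → C ℚ.≤ q + q → lower q ≡ C × upper q ≡ (q + q) - C
  large q h = ℚₚ.p≥q⇒p⊓q≡q h , ℚₚ.p≥q⇒p⊔q≡p (0≤q-p h)

  p+[q-p] : ∀ p q → p + (q - p) ≡ q
  p+[q-p] = solve 2 (λ p q → p :+ (q :- p) := q) refl where open +-*-Solver

  lower+upper : ∀ q → lower q + upper q ≡ q + q
  lower+upper q = by (ℚₚ.≤-total (q + q) C)
    where
    by : q + q ℚ.≤ C ⊎ C ℚ.≤ q + q → lower q + upper q ≡ q + q
    by (inj₁ h) = trans (cong₂ _+_ (proj₁ (small q h)) (proj₂ (small q h))) (ℚₚ.+-identityʳ (q + q))
    by (inj₂ h) = trans (cong₂ _+_ (proj₁ (large q h)) (proj₂ (large q h))) (p+[q-p] C (q + q))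

  lower0 : lower 0ℚ ≡ 0ℚ
  lower0 = proj₁ (small 0ℚ 0≤C)

  upper0 : upper 0ℚ ≡ 0ℚ
  upper0 = proj₂ (small 0ℚ 0≤C)

  lower≤C : ∀ q → q ℚ.≤ C → lower q ℚ.≤ C
  lower≤C q _ = ℚₚ.p⊓q≤q (q + q) C

  upper≤C : ∀ q → q ℚ.≤ C → upper q ℚ.≤ C
  upper≤C q q≤C = ℚₚ.⊔-lub (ℚₚ.≤-trans (ℚₚ.+-monoˡ-≤ (- C) (ℚₚ.+-mono-≤ q≤C q≤C))
    (ℚₚ.≤-reflexive (solve 1 (λ p → (p :+ p) :- p := p) refl C))) 0≤C
    where open +-*-Solver

  -- `x` is the midpoint of the two cuts, and both lie in the polytope, so at a vertex they
  -- coincide.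
  lower≡upper : ∀ k l → InTri n k l → cut lower k l ≡ cut upper k l
  lower≡upper k l (p , q , r) = proj₂ vertex (cut lower) (cut upper) ½
    (cut-FFLV lower upper lower-mono upper-mono lower+upper lower0 lower≤C)
    (cut-FFLV upper lower upper-mono lower-mono (λ q → trans (ℚₚ.+-comm (upper q) (lower q)) (lower+upper q)) upper0 upper≤C)
    (ℚₚ.positive⁻¹ ½) ½<1
    (λ k l p q r → trans (halve (x k l)) (trans
      (cong (½ *_) (sym (cut-sum lower upper lower+upper k l (p , q , r))))
      (ℚₚ.*-distribˡ-+ ½ (cut lower k l) (cut upper k l))))
    k l p q r

  Dichotomy : ℚ → Set
  Dichotomy q = q ≡ 0ℚ ⊎ q ≡ C

  ⊔-dichotomy : ∀ p q → Dichotomy p → Dichotomy q → Dichotomy (p ⊔ q)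
  ⊔-dichotomy p q dp dq = by (ℚₚ.⊔-sel p q)
    where
    by : p ⊔ q ≡ p ⊎ p ⊔ q ≡ q → Dichotomy (p ⊔ q)
    by (inj₁ e) = subst Dichotomy (sym e) dp
    by (inj₂ e) = subst Dichotomy (sym e) dq

  -- Below the threshold the equation reads `2q = 0`, above it `C = 2q - C`.
  lower≡upper⇒dichotomy : ∀ q → lower q ≡ upper q → Dichotomy q
  lower≡upper⇒dichotomy q eq = by (ℚₚ.≤-total (q + q) C)
    where
    by : q + q ℚ.≤ C ⊎ C ℚ.≤ q + q → Dichotomy q
    by (inj₁ h) = inj₁ (double-injective q 0ℚ (trans (sym (proj₁ (small q h))) (trans eq (proj₂ (small q h)))))
    by (inj₂ h) = inj₂ (double-injective q C (trans (sym (p+[q-p] C (q + q)))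
      (cong (C +_) (trans (sym (proj₂ (large q h))) (trans (sym eq) (proj₁ (large q h)))))))

  -- Induction over the two predecessors. If `prev` is 0, each cut is its function applied to `φ`,
  -- and the coincidence of the cuts decides `φ`. If `prev` is `C`, then `φ` is squeezed between `C`
  -- and `C`.
  φ-dichotomy : ∀ k l → l ≤ n → Dichotomy (φ k l)
  φ-dichotomy zero    l       l≤n = inj₁ (φ-zero l)
  φ-dichotomy (suc k) zero    l≤n = inj₁ (φ-outside (suc k) 0 z≤n)
  φ-dichotomy (suc k) (suc l) l≤n = split (ℕₚ.≤-<-connex l k)
    where
    split : l ≤ k ⊎ k < l → Dichotomy (φ (suc k) (suc l))
    split (inj₁ l≤k) = inj₁ (φ-outside (suc k) (suc l) (s≤s l≤k))
    split (inj₂ k<l) = by (⊔-dichotomy (φ k (suc l)) (φ (suc k) l) (φ-dichotomy k (suc l) l≤n)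
                            (φ-dichotomy (suc k) l (ℕₚ.<⇒≤ l≤n)))
      where
      tri : InTri n (suc k) (suc l)
      tri = s≤s z≤n , s≤s k<l , l≤n

      at-0 : prev (suc k) (suc l) ≡ 0ℚ → ∀ g → g 0ℚ ≡ 0ℚ → cut g (suc k) (suc l) ≡ g (φ (suc k) (suc l))
      at-0 e g g0 = trans (cong (λ q → g (φ (suc k) (suc l)) - q) (trans (cong g e) g0)) (p-0≡p (g (φ (suc k) (suc l))))

      by : Dichotomy (prev (suc k) (suc l)) → Dichotomy (φ (suc k) (suc l))
      by (inj₁ e) = lower≡upper⇒dichotomy (φ (suc k) (suc l))
        (trans (sym (at-0 e lower lower0)) (trans (lower≡upper (suc k) (suc l) tri) (at-0 e upper upper0)))
      by (inj₂ e) = inj₂ (ℚₚ.≤-antisym (φ≤C (suc k) (suc l) tri)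
                           (ℚₚ.≤-trans (ℚₚ.≤-reflexive (sym e)) (prev≤φ (suc k) (suc l) tri)))

  x-dichotomy : ∀ k l → InTri n k l → Dichotomy (x k l)
  x-dichotomy k l tri@(1≤k , k<l , l≤n) = by (φ-dichotomy k l l≤n)
      (⊔-dichotomy (φ (k ∸ 1) l) (φ k (l ∸ 1)) (φ-dichotomy (k ∸ 1) l l≤n)
        (φ-dichotomy k (l ∸ 1) (ℕₚ.≤-trans (ℕₚ.m∸n≤m l 1) l≤n)))
    where
    x≡ : x k l ≡ φ k l - prev k l
    x≡ = trans (sym (p+q-q (x k l) (prev k l))) (cong (_- prev k l) (sym (φ-step k l 1≤k k<l)))
    by : Dichotomy (φ k l) → Dichotomy (prev k l) → Dichotomy (x k l)
    by (inj₁ d) (inj₁ e) = inj₁ (trans x≡ (trans (cong₂ _-_ d e) (p-p≡0 0ℚ)))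
    by (inj₂ d) (inj₁ e) = inj₂ (trans x≡ (trans (cong₂ _-_ d e) (p-0≡p C)))
    by (inj₂ d) (inj₂ e) = inj₁ (trans x≡ (trans (cong₂ _-_ d e) (p-p≡0 C)))
    by (inj₁ d) (inj₂ e) = ⊥-elim (C≢0 (ℚₚ.≤-antisym (subst₂ ℚ._≤_ e d (prev≤φ k l tri)) 0≤C))

  -- Some Dyck path with range from `k` to `l - 1` passes through the point. Were `i` outside that
  -- range, the path would have bound 0, less than `C`.
  x≡C⇒inside : ∀ k l → InTri n k l → x k l ≡ C → k ≤ i × i < l
  x≡C⇒inside k (suc l) tri@(1≤k , s≤s k≤l , l≤n) xC = by (in-or-out i k l)
    where
    π : Path k (suc k) k (suc l)
    π = vertical (s≤s k≤l)
    ρ : Path k (suc l) l (suc l)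
    ρ = horizontal k≤l ℕₚ.≤-refl
    C≤0 : i < k ⊎ l < i → C ℚ.≤ 0ℚ
    C≤0 out = ℚₚ.≤-trans (ℚₚ.≤-reflexive (sym xC))
      (ℚₚ.≤-trans (total-≥ x x-nonneg 1≤k ℕₚ.≤-refl l≤n (On-++ʳ π {ρ} here))
        (ℚₚ.≤-trans (x-bound 1≤k l≤n (π ++ₚ ρ)) (ℚₚ.≤-reflexive (weight-out i c k l out))))
    by : (k ≤ i × i ≤ l) ⊎ (i < k ⊎ l < i) → k ≤ i × i < suc l
    by (inj₁ (k≤i , i≤l)) = k≤i , s≤s i≤l
    by (inj₂ out)         = ⊥-elim (C≢0 (ℚₚ.≤-antisym (C≤0 out) 0≤C))

  -- Two distinct comparable points lie on a common Dyck path, whose sum would be at least `2C`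
  -- although its bound is at most `C`.
  x≡C⇒anti : ∀ k l k′ l′ → InTri n k l → InTri n k′ l′ → x k l ≡ C → x k′ l′ ≡ C →
             k ≤ k′ → l ≤ l′ → k ≡ k′ × l ≡ l′
  x≡C⇒anti k l k′ (suc l′) (1≤k , k<l , l≤n) (_ , s≤s k′≤l′ , l′≤n) xC xC′ k≤k′ l≤l′ =
    decidable-stable (k ℕ.≟ k′ ×-dec l ℕ.≟ suc l′) λ ≢end → (ℚₚ.<-irrefl refl (ℚₚ.<-≤-trans 2C (ℚₚ.≤-trans
      (ℚₚ.+-mono-≤ (ℚₚ.≤-trans (ℚₚ.≤-reflexive (sym xC)) (total-≥ x x-nonneg 1≤k ℕₚ.≤-refl l≤n (On-end π)))
        (ℚₚ.≤-trans (ℚₚ.≤-reflexive (sym xC′)) (after-≥end x x-nonneg 1≤k k<l l′≤n ρ ≢end)))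
      (ℚₚ.≤-trans (≤-+ʳ ℚₚ.≤-refl (after-nonneg x x-nonneg (ℕₚ.≤-trans 1≤k k≤k′) (s≤s k′≤l′) l′≤n σ))
        (ℚₚ.≤-trans (ℚₚ.≤-reflexive (sym (trans (total-++ x (π ++ₚ ρ) σ) (cong (_+ after x σ) (total-++ x π ρ)))))
          (ℚₚ.≤-trans (x-bound 1≤k l′≤n ((π ++ₚ ρ) ++ₚ σ)) (weight-≤ i c k l′)))))))
    where
    π : Path k (suc k) k l
    π = vertical k<l
    ρ : Path k l k′ (suc l′)
    ρ = route k≤k′ l≤l′ (s≤s k′≤l′)
    σ : Path k′ (suc l′) l′ (suc l′)
    σ = horizontal k′≤l′ ℕₚ.≤-refl
    2C : C ℚ.< C + C
    2C = subst (ℚ._< C + C) (ℚₚ.+-identityʳ C) (ℚₚ.+-monoʳ-< C 0<C)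

-- The antichain of a vertex

InSupport : ℕ → ℕ → ℕ → Pt → ℕ → ℕ → Set
InSupport n i c x k l = ((1 ≤ k × k ≤ i) × (i < l × l ≤ n)) × x k l ≡ toℚ c

abstract
  inSupport? : ∀ n i c x k l → Dec (InSupport n i c x k l)
  inSupport? n i c x k l =
    ((1 ℕ.≤? k ×-dec k ℕ.≤? i) ×-dec (i ℕ.<? l ×-dec l ℕ.≤? n)) ×-dec x k l ℚ.≟ toℚ c

support : ℕ → ℕ → ℕ → Pt → ℕ → ℕ → Bool
support n i c x k l = does (inSupport? n i c x k l)

does-true : ∀ {P : Set} (P? : Dec P) → does P? ≡ true → P
does-true (yes p) _ = p

module _ (n i c : ℕ) (0<c : 0 < c) (x : Pt) (vertex : IsVertex n (FFLV n (single i c)) x) where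

  open Vertex n i c 0<c x vertex

  support-antichain : Antichain n i (support n i c x)
  support-antichain = record
    { inside = λ {k} {l} p → proj₁ (in-support k l p)
    ; anti   = λ {k} {l} {k′} {l′} p q →
        x≡C⇒anti k l k′ l′ (tri k l p) (tri k′ l′ q) (proj₂ (in-support k l p)) (proj₂ (in-support k′ l′ q)) }
    where
    in-support : ∀ k l → support n i c x k l ≡ true → InSupport n i c x k l
    in-support k l = does-true (inSupport? n i c x k l)
    tri : ∀ k l → support n i c x k l ≡ true → InTri n k l
    tri k l p = let (1≤k , k≤i) , (i<l , l≤n) = proj₁ (in-support k l p) in 1≤k , ℕₚ.≤-<-trans k≤i i<l , l≤n

  vertex≡support : ∀ k l → InTri n k l → x k l ≡ toℚ c * 𝟙 (support n i c x) k l
  vertex≡support k l tri@(1≤k , _ , l≤n) = by (x-dichotomy k l tri)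
    where
    by : Dichotomy (x k l) → x k l ≡ C * 𝟙 (support n i c x) k l
    by (inj₂ xC) = trans xC (sym (trans (cong (λ b → C * χ b) (dec-true (inSupport? n i c x k l)
        (let k≤i , i<l = x≡C⇒inside k l tri xC in ((1≤k , k≤i) , (i<l , l≤n)) , xC))) (ℚₚ.*-identityʳ C)))
    by (inj₁ x0) = trans x0 (sym (trans (cong (λ b → C * χ b) (dec-false (inSupport? n i c x k l)
        (λ p → C≢0 (trans (sym (proj₂ p)) x0)))) (ℚₚ.*-zeroʳ C)))

-- Rigid pairs of antichains

Comparable : ℕ → ℕ → ℕ → ℕ → Set
Comparable k l k′ l′ = (k ≤ k′ × l ≤ l′) ⊎ (k′ ≤ k × l′ ≤ l)

-- Every component of the comparability graph on the symmetric difference of A and B contains a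
-- point (k , i+1) of A or a point (i+1 , l) of B, i.e. a point outside R_i ∩ R_{i+1}.
Rigid : ℕ → (A B : ℕ → ℕ → Bool) → Set
Rigid i A B = (f : ℕ → ℕ → Bool) →
  (∀ {k l k′ l′} → A k l ≡ true → B k l ≡ false → B k′ l′ ≡ true → A k′ l′ ≡ false →
     Comparable k l k′ l′ → f k l ≡ f k′ l′) →
  (∀ {k} → A k (suc i) ≡ true → f k (suc i) ≡ false) →
  (∀ {l} → B (suc i) l ≡ true → A (suc i) l ≡ false → f (suc i) l ≡ false) →
  (∀ {k l} → A k l ≡ true → B k l ≡ false → f k l ≡ false) ×
  (∀ {k l} → B k l ≡ true → A k l ≡ false → f k l ≡ false)

Hit : (ℕ → ℕ → Bool) → ∀ {k l k′ l′} → Path k l k′ l′ → Set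
Hit A π = ∃ λ r → ∃ λ t → A r t ≡ true × On r t π

true≢false : ∀ {b} → b ≡ true → ¬ b ≡ false
true≢false refl ()

search : ∀ n {P : ℕ → ℕ → Set} → (∀ k l → Dec (P k l)) → (∀ {k l} → P k l → k ≤ n × l ≤ n) →
         Dec (∃ λ k → ∃ λ l → P k l)
search n P? bounded = map′
  (λ { (k , _ , l , _ , p) → k , l , p })
  (λ { (k , l , p) → k , s≤s (proj₁ (bounded p)) , l , s≤s (proj₂ (bounded p)) , p })
  (ℕₚ.anyUpTo? (λ k → ℕₚ.anyUpTo? (P? k) (suc n)) (suc n))

module Neighbours {n i A B} (acA : Antichain n i A) (acB : Antichain n (suc i) B) (rigid : Rigid i A B) where

  Above Below : ℕ → ℕ → Set
  Above k l = ∃ λ k′ → ∃ λ l′ → B k′ l′ ≡ true × k ≤ k′ × l ≤ l′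
  Below k l = ∃ λ k′ → ∃ λ l′ → A k′ l′ ≡ true × k′ ≤ k × l′ ≤ l

  bounds : ∀ {i A} → Antichain n i A → ∀ {k l} → A k l ≡ true → k ≤ n × l ≤ n
  bounds ac p = let _ , k<l , l≤n = inTri ac p in ℕₚ.≤-trans (ℕₚ.<⇒≤ k<l) l≤n , l≤n

  above? : ∀ k l → Dec (Above k l)
  above? k l = search n (λ k′ l′ → (B k′ l′ Bool.≟ true) ×-dec (k ℕ.≤? k′ ×-dec l ℕ.≤? l′))
                        (λ p → bounds acB (proj₁ p))

  below? : ∀ k l → Dec (Below k l)
  below? k l = search n (λ k′ l′ → (A k′ l′ Bool.≟ true) ×-dec (k′ ℕ.≤? k ×-dec l′ ℕ.≤? l))
                        (λ p → bounds acA (proj₁ p))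

  -- Being bad is constant along comparabilities: in a pair a ≤ b neither point is bad, in a pair
  -- b ≤ a both are, because A and B are antichains.
  Bad : ℕ → ℕ → Set
  Bad k l = (A k l ≡ true × suc i < l × ¬ Above k l) ⊎ (A k l ≡ false × k ≤ i × ¬ Below k l)

  bad? : ∀ k l → Dec (Bad k l)
  bad? k l = ((A k l Bool.≟ true) ×-dec (suc i ℕ.<? l ×-dec ¬? (above? k l)))
       ⊎-dec ((A k l Bool.≟ false) ×-dec (k ℕ.≤? i ×-dec ¬? (below? k l)))

  bad : ℕ → ℕ → Bool
  bad k l = does (bad? k l)

  -- Rigidity applied to the set of bad points. Points outside the common rectangle are not bad,
  -- because `Bad` asks for `suc i < l` on `A` and for `k ≤ i` off `A`.
  not-bad : (∀ {k l} → A k l ≡ true → B k l ≡ false → bad k l ≡ false) ×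
            (∀ {k l} → B k l ≡ true → A k l ≡ false → bad k l ≡ false)
  not-bad = rigid bad const
      (λ {k} a → dec-false (bad? k (suc i)) (λ
        { (inj₁ (_ , lt , _)) → ℕₚ.<-irrefl refl lt
        ; (inj₂ (¬a , _))     → true≢false a ¬a }))
      (λ {l} _ ¬a → dec-false (bad? (suc i) l) (λ
        { (inj₁ (a , _))     → true≢false a ¬a
        ; (inj₂ (_ , le , _)) → ℕₚ.<-irrefl refl le }))
    where
    const : ∀ {k l k′ l′} → A k l ≡ true → B k l ≡ false → B k′ l′ ≡ true → A k′ l′ ≡ false →
            Comparable k l k′ l′ → bad k l ≡ bad k′ l′
    const {k} {l} {k′} {l′} a ¬b b′ ¬a′ (inj₁ (k≤k′ , l≤l′)) = trans
      (dec-false (bad? k l) (λ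
        { (inj₁ (_ , _ , ¬above)) → ¬above (k′ , l′ , b′ , k≤k′ , l≤l′)
        ; (inj₂ (¬a , _))         → true≢false a ¬a }))
      (sym (dec-false (bad? k′ l′) (λ
        { (inj₁ (a′ , _))         → true≢false a′ ¬a′
        ; (inj₂ (_ , _ , ¬below)) → ¬below (k , l , a , k≤k′ , l≤l′) })))
    const {k} {l} {k′} {l′} a ¬b b′ ¬a′ (inj₂ (k′≤k , l′≤l)) = trans
      (dec-true (bad? k l) (inj₁ (a , ℕₚ.<-≤-trans (proj₁ (proj₂ (inside acB b′))) l′≤l , ¬above)))
      (sym (dec-true (bad? k′ l′) (inj₂ (¬a′ , ℕₚ.≤-trans k′≤k (proj₂ (proj₁ (inside acA a))) , ¬below))))
      where
      ¬above : ¬ Above k l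
      -- A point of `B` above `(k , l)` is also above `(k′ , l′)`, hence equal to it. Then
      -- `(k , l)`, squeezed in between, lies in `B` as well, against `¬b`.
      ¬above (r , t , b , k≤r , l≤t) with anti acB b′ b (ℕₚ.≤-trans k′≤k k≤r) (ℕₚ.≤-trans l′≤l l≤t)
      ... | refl , refl with ℕₚ.≤-antisym k′≤k k≤r | ℕₚ.≤-antisym l′≤l l≤t
      ...   | refl | refl = true≢false b ¬b
      ¬below : ¬ Below k′ l′
      ¬below (r , t , a₀ , r≤k′ , t≤l′) with anti acA a₀ a (ℕₚ.≤-trans r≤k′ k′≤k) (ℕₚ.≤-trans t≤l′ l′≤l)
      ... | refl , refl with ℕₚ.≤-antisym k′≤k r≤k′ | ℕₚ.≤-antisym l′≤l t≤l′
      ...   | refl | refl = true≢false a₀ ¬a′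

  dec-false⁻¹ : ∀ {P : Set} (P? : Dec P) → does P? ≡ false → ¬ P
  dec-false⁻¹ (no ¬p) _ = ¬p

  above : ∀ {k l} → A k l ≡ true → B k l ≡ false → suc i < l → Above k l
  above {k} {l} a ¬b lt = decidable-stable (above? k l) (λ ¬above →
    dec-false⁻¹ (bad? k l) (proj₁ not-bad a ¬b) (inj₁ (a , lt , ¬above)))

  below : ∀ {k l} → B k l ≡ true → A k l ≡ false → k ≤ i → Below k l
  below {k} {l} b ¬a le = decidable-stable (below? k l) (λ ¬below →
    dec-false⁻¹ (bad? k l) (proj₂ not-bad b ¬a) (inj₂ (¬a , le , ¬below)))

  -- In the opposite order, `above` supplies a point of `B` over the point of `A`, hence over the
  -- given point of `B`. The antichain property identifies these two, so the asserted order holds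
  -- after all.
  ascending : ∀ {k l k′ l′} → A k l ≡ true → B k l ≡ false → B k′ l′ ≡ true →
              Comparable k l k′ l′ → k ≤ k′ × l ≤ l′
  ascending a ¬b b′ (inj₁ le) = le
  ascending a ¬b b′ (inj₂ (k′≤k , l′≤l)) with above a ¬b (ℕₚ.<-≤-trans (proj₁ (proj₂ (inside acB b′))) l′≤l)
  ... | r , t , b , k≤r , l≤t with anti acB b′ b (ℕₚ.≤-trans k′≤k k≤r) (ℕₚ.≤-trans l′≤l l≤t)
  ...   | refl , refl = k≤r , l≤t

-- Sums of a difference along tight paths

module Potential
  (n : ℕ) (A : ℕ → ℕ → ℕ → Bool) (ac : ∀ s → Antichain n s (A s))
  (rigid : ∀ i → 1 ≤ i → suc i < n → Rigid i (A i) (A (suc i)))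
  (δ : Pt)
  (null : ∀ k l → InTri n k l → (∀ s → A s k l ≡ false) → δ k l ≡ 0ℚ)
  (tight : ∀ {j j′} → 1 ≤ j → j′ < n → (π : DyckPath j j′) →
           (∀ s → j ≤ s → s ≤ j′ → Hit (A s) π) → total δ π ≡ 0ℚ)
  where

  -- An initial piece of a tight path: it leaves the diagonal at `start` and meets every antichain
  -- from there up to index `i`. `Right` is a matching final piece, from index `i` on.
  record Left (i k l : ℕ) : Set where
    constructor mkLeft
    field
      {start} : ℕ
      1≤start : 1 ≤ start
      path    : Path start (suc start) k l
      hits    : ∀ s → start ≤ s → s ≤ i → Hit (A s) path

  record Right (i k l : ℕ) : Set where
    constructor mkRight
    field
      {end} : ℕ
      end<n : end < n
      path  : Path k l end (suc end)
      hits  : ∀ s → i ≤ s → s ≤ end → Hit (A s) path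

  leftSum : ∀ {i k l} → Left i k l → ℚ
  leftSum L = total δ (Left.path L)

  -- The point `(k , l)` is already counted in `leftSum`.
  rightSum : ∀ {i k l} → Right i k l → ℚ
  rightSum R = after δ (Right.path R)

  Hit-++ˡ : ∀ {B k l k′ l′ k″ l″} {π : Path k l k′ l′} (ρ : Path k′ l′ k″ l″) → Hit B π → Hit B (π ++ₚ ρ)
  Hit-++ˡ ρ (r , t , b , on) = r , t , b , On-++ˡ ρ on

  Hit-++ʳ : ∀ {B k l k′ l′ k″ l″} (π : Path k l k′ l′) {ρ : Path k′ l′ k″ l″} → Hit B ρ → Hit B (π ++ₚ ρ)
  Hit-++ʳ π (r , t , b , on) = r , t , b , On-++ʳ π on

  -- The two pieces glue to a path that meets every antichain in its range, so `tight` applies.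
  balance : ∀ {i k l} (L : Left i k l) (R : Right i k l) → leftSum L + rightSum R ≡ 0ℚ
  balance {i} (mkLeft 1≤j π hits) (mkRight j′<n ρ hits′) =
    trans (sym (total-++ δ π ρ)) (tight 1≤j j′<n (π ++ₚ ρ) hit)
    where
    hit : ∀ s → _ ≤ s → s ≤ _ → Hit (A s) (π ++ₚ ρ)
    hit s j≤s s≤j′ with ℕₚ.≤-total s i
    ... | inj₁ s≤i = Hit-++ˡ ρ (hits s j≤s s≤i)
    ... | inj₂ i≤s = Hit-++ʳ π (hits′ s i≤s s≤j′)

  leftStart : ∀ {i l} → A i i l ≡ true → Left i i l
  leftStart {i} {l} a = mkLeft (proj₁ (proj₁ (inside (ac i) a))) π
      (λ { s i≤s s≤i → hit s (ℕₚ.≤-antisym i≤s s≤i) })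
    where
    π : Path i (suc i) i l
    π = vertical (proj₁ (proj₂ (inside (ac i) a)))
    hit : ∀ s → i ≡ s → Hit (A s) π
    hit s refl = i , l , a , On-end π

  leftKeep : ∀ {i k l} → A (suc i) k l ≡ true → Left i k l → Left (suc i) k l
  leftKeep {i} {k} {l} a (mkLeft {j} 1≤j π hits) = mkLeft 1≤j π (λ s j≤s s≤ → hit s j≤s (ℕₚ.m≤n⇒m<n∨m≡n s≤))
    where
    hit : ∀ s → j ≤ s → s < suc i ⊎ s ≡ suc i → Hit (A s) π
    hit s j≤s (inj₁ (s≤s s≤i)) = hits s j≤s s≤i
    hit s j≤s (inj₂ refl)      = k , l , a , On-end π

  leftExtend : ∀ {i k l k′ l′} → Left i k l → A (suc i) k′ l′ ≡ true → Path k l k′ l′ → Left (suc i) k′ l′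
  leftExtend {i} {k} {l} {k′} {l′} (mkLeft {j} 1≤j π hits) a ρ =
    mkLeft 1≤j (π ++ₚ ρ) (λ s j≤s s≤ → hit s j≤s (ℕₚ.m≤n⇒m<n∨m≡n s≤))
    where
    hit : ∀ s → j ≤ s → s < suc i ⊎ s ≡ suc i → Hit (A s) (π ++ₚ ρ)
    hit s j≤s (inj₁ (s≤s s≤i)) = Hit-++ˡ ρ (hits s j≤s s≤i)
    hit s j≤s (inj₂ refl)      = k′ , l′ , a , On-end (π ++ₚ ρ)

  rightEnd : ∀ {i k} → A i k (suc i) ≡ true → Right i k (suc i)
  rightEnd {i} {k} a = mkRight (proj₂ (proj₂ (inside (ac i) a))) π
      (λ s i≤s s≤i → hit s (ℕₚ.≤-antisym i≤s s≤i))
    where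
    π : Path k (suc i) i (suc i)
    π = horizontal (proj₂ (proj₁ (inside (ac i) a))) ℕₚ.≤-refl
    hit : ∀ s → i ≡ s → Hit (A s) π
    hit s refl = k , suc i , a , here

  rightExtend : ∀ {i k l k′ l′} → A i k l ≡ true → Path k l k′ l′ → Right (suc i) k′ l′ → Right i k l
  rightExtend {i} {k} {l} {k′} {l′} a ρ (mkRight {j} j<n π hits) =
    mkRight j<n (ρ ++ₚ π) (λ s ≤s s≤j → hit s (ℕₚ.m≤n⇒m<n∨m≡n ≤s) s≤j)
    where
    hit : ∀ s → i < s ⊎ i ≡ s → s ≤ j → Hit (A s) (ρ ++ₚ π)
    hit s (inj₁ i<s)  s≤j = Hit-++ʳ ρ (hits s i<s s≤j)
    hit s (inj₂ refl) _   = k , l , a , here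

  module At {i k l} (a : A i k l ≡ true) where
    1≤k = proj₁ (proj₁ (inside (ac i) a))
    k≤i = proj₂ (proj₁ (inside (ac i) a))
    i<l = proj₁ (proj₂ (inside (ac i) a))
    l≤n = proj₂ (proj₂ (inside (ac i) a))
    k<l = ℕₚ.≤-<-trans k≤i i<l
    1≤i = ℕₚ.≤-trans 1≤k k≤i

  -- Induction on the index. A point whose first coordinate equals the index is reached straight
  -- from the diagonal; a point shared with the previous antichain keeps its path; any other one has
  -- a point of the previous antichain below it, whose path is extended.
  toLeft : ∀ i k l → A i k l ≡ true → Left i k l
  toLeft zero    k l a = ⊥-elim (ℕₚ.n≮0 (At.1≤i a))
  toLeft (suc i) k l a = by (ℕₚ.m≤n⇒m<n∨m≡n (At.k≤i a)) (A i k l Bool.≟ true)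
    where
    by : k < suc i ⊎ k ≡ suc i → Dec (A i k l ≡ true) → Left (suc i) k l
    by (inj₂ refl)      _       = leftStart a
    by (inj₁ _)         (yes a′) = leftKeep a (toLeft i k l a′)
    by (inj₁ (s≤s k≤i)) (no ¬a) =
      let r , t , a′ , r≤k , t≤l =
            Neighbours.below (ac i) (ac (suc i))
              (rigid i (ℕₚ.≤-trans (At.1≤k a) k≤i) (ℕₚ.<-≤-trans (At.i<l a) (At.l≤n a)))
              a (≢true ¬a) k≤i
      in leftExtend (toLeft i r t a′) a (route r≤k t≤l (At.k<l a))

  -- Mirror image of `toLeft`. The index now grows, and `d` bounds how many indices remain before
  -- `n`.
  toRight′ : ∀ d i k l → n ≤ d ℕ.+ i → A i k l ≡ true → Right i k l
  toRight′ zero    i k l n≤i a = ⊥-elim (ℕₚ.<⇒≱ (ℕₚ.<-≤-trans (At.i<l a) (At.l≤n a)) n≤i)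
  toRight′ (suc d) i k l n≤ a = by (ℕₚ.m≤n⇒m<n∨m≡n (At.i<l a)) (A (suc i) k l Bool.≟ true)
    where
    n≤′ : n ≤ d ℕ.+ suc i
    n≤′ = ℕₚ.≤-trans n≤ (ℕₚ.≤-reflexive (sym (ℕₚ.+-suc d i)))
    by : suc i < l ⊎ suc i ≡ l → Dec (A (suc i) k l ≡ true) → Right i k l
    by (inj₂ refl) _        = rightEnd a
    by (inj₁ _)    (yes a′) = rightExtend a stop (toRight′ d (suc i) k l n≤′ a′)
    by (inj₁ lt)   (no ¬a)  =
      let r , t , a′ , k≤r , l≤t =
            Neighbours.above (ac i) (ac (suc i))
              (rigid i (At.1≤i a) (ℕₚ.<-≤-trans lt (At.l≤n a)))
              a (≢true ¬a) lt
      in rightExtend a (route k≤r l≤t (At.k<l a′)) (toRight′ d (suc i) r t n≤′ a′)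

  toRight : ∀ i k l → A i k l ≡ true → Right i k l
  toRight i k l = toRight′ n i k l (ℕₚ.m≤m+n n i)

  -- A point of `A s` beyond the end of the piece would lie above the point where the piece meets
  -- `A s`. For `s` before the start, its first coordinate would be too large for the rectangle of
  -- `A s`.
  left-null : ∀ {i k l r t} → Left i k l → k ≤ r → l ≤ t → ¬ (r ≡ k × t ≡ l) → ∀ s → s ≤ i → A s r t ≡ false
  left-null {i} {k} {l} {r} {t} (mkLeft {j} _ π hits) k≤r l≤t ≢p s s≤i = ≢true (λ a → by a (ℕₚ.≤-<-connex j s))
    where
    by : A s r t ≡ true → j ≤ s ⊎ s < j → ⊥
    by a (inj₂ s<j) = ℕₚ.<⇒≱ s<j (ℕₚ.≤-trans (proj₁ (path-≤ π)) (ℕₚ.≤-trans k≤r (At.k≤i a)))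
    by a (inj₁ j≤s) with hits s j≤s s≤i
    ... | r′ , t′ , a′ , on with On-≤end on
    ...   | r′≤k , t′≤l with anti (ac s) a′ a (ℕₚ.≤-trans r′≤k k≤r) (ℕₚ.≤-trans t′≤l l≤t)
    ...     | refl , refl = ≢p (ℕₚ.≤-antisym r′≤k k≤r , ℕₚ.≤-antisym t′≤l l≤t)

  right-null : ∀ {i k l r t} → Right i k l → r ≤ k → t ≤ l → ¬ (r ≡ k × t ≡ l) → ∀ s → i ≤ s → A s r t ≡ false
  right-null {i} {k} {l} {r} {t} (mkRight {j} _ π hits) r≤k t≤l ≢p s i≤s = ≢true (λ a → by a (ℕₚ.≤-<-connex s j))
    where
    by : A s r t ≡ true → s ≤ j ⊎ j < s → ⊥
    by a (inj₂ j<s) = ℕₚ.<⇒≱ (At.i<l a) (ℕₚ.≤-trans t≤l (ℕₚ.≤-trans (proj₂ (path-≤ π)) j<s))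
    by a (inj₁ s≤j) with hits s i≤s s≤j
    ... | r′ , t′ , a′ , on with On-≥start on
    ...   | k≤r′ , l≤t′ with anti (ac s) a a′ (ℕₚ.≤-trans r≤k k≤r′) (ℕₚ.≤-trans t≤l l≤t′)
    ...     | refl , refl = ≢p (ℕₚ.≤-antisym r≤k k≤r′ , ℕₚ.≤-antisym t≤l l≤t′)

  opposite : ∀ p q → p + q ≡ 0ℚ → p ≡ - q
  opposite p q e = trans (sym (p+q-q p q)) (trans (cong (_- q) e) (ℚₚ.+-identityˡ (- q)))

  leftSum≡ : ∀ {i k l} → A i k l ≡ true → (L L′ : Left i k l) → leftSum L ≡ leftSum L′
  leftSum≡ {i} {k} {l} a L L′ =
    trans (opposite (leftSum L) (rightSum R) (balance L R)) (sym (opposite (leftSum L′) (rightSum R) (balance L′ R)))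
    where
    R : Right i k l
    R = toRight i k l a

  -- h i k l is the sum of δ along a tight path up to its point (k , l) of A i; it does not depend on
  -- the path, being the opposite of the sum along any way to complete the path.
  abstract
    h : ℕ → ℕ → ℕ → ℚ
    h i k l with A i k l Bool.≟ true
    ... | yes a = leftSum (toLeft i k l a)
    ... | no _  = 0ℚ

    h≡ : ∀ {i k l} → A i k l ≡ true → (L : Left i k l) → h i k l ≡ leftSum L
    h≡ {i} {k} {l} a L with A i k l Bool.≟ true
    ... | yes a′ = leftSum≡ a (toLeft i k l a′) L
    ... | no ¬a  = contradiction a ¬a

  -- On the vertical way up to `(i , l)` all earlier points avoid every antichain: those of index at
  -- least `i` by `right-null`, the others because the first coordinate `i` exceeds their index.
  h-start : ∀ {i l} → A i i l ≡ true → h i i l ≡ δ i l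
  h-start {i} {l} a = trans (h≡ a (leftStart a)) (total-end δ ℕₚ.≤-refl (Left.path (leftStart a))
    (λ r t r<t i≤r _ r≤i t≤l ≢p → null r t (ℕₚ.≤-trans (At.1≤k a) i≤r , r<t , ℕₚ.≤-trans t≤l (At.l≤n a))
      (λ s → by r t i≤r r≤i t≤l ≢p s (ℕₚ.≤-<-connex i s))))
    where
    by : ∀ r t → i ≤ r → r ≤ i → t ≤ l → ¬ (r ≡ i × t ≡ l) → ∀ s → i ≤ s ⊎ s < i → A s r t ≡ false
    by r t i≤r r≤i t≤l ≢p s (inj₁ i≤s) = right-null (toRight i i l a) r≤i t≤l ≢p s i≤s
    by r t i≤r r≤i t≤l ≢p s (inj₂ s<i) = ≢true (λ a′ → ℕₚ.<⇒≱ s<i (ℕₚ.≤-trans i≤r (At.k≤i a′)))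

  -- Dually, nothing contributes after `(k , suc i)` on the horizontal way to the diagonal, and
  -- `balance` turns the vanishing right sum into the claim.
  h-end : ∀ {i k} → A i k (suc i) ≡ true → h i k (suc i) ≡ 0ℚ
  h-end {i} {k} a = trans (h≡ a L) (trans (opposite (leftSum L) (rightSum R) (balance L R)) (cong -_ R≡0))
    where
    L : Left i k (suc i)
    L = toLeft i k (suc i) a
    R : Right i k (suc i)
    R = rightEnd a
    by : ∀ r t → k ≤ r → suc i ≤ t → t ≤ suc i → ¬ (r ≡ k × t ≡ suc i) → ∀ s → s ≤ i ⊎ i < s → A s r t ≡ false
    by r t k≤r i<t t≤ ≢p s (inj₁ s≤i) = left-null L k≤r i<t ≢p s s≤i
    by r t k≤r i<t t≤ ≢p s (inj₂ i<s) = ≢true (λ a′ → ℕₚ.<⇒≱ (At.i<l a′) (ℕₚ.≤-trans t≤ i<s))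
    R≡0 : rightSum R ≡ 0ℚ
    R≡0 = after-null δ (At.k<l a) (Right.path R)
      (λ r t r<t k≤r i<t _ t≤ ≢p → null r t (ℕₚ.≤-trans (At.1≤k a) k≤r , r<t , ℕₚ.≤-trans t≤ (At.l≤n a))
        (λ s → by r t k≤r i<t t≤ ≢p s (ℕₚ.≤-<-connex s i)))

  h-keep : ∀ {i k l} → A i k l ≡ true → A (suc i) k l ≡ true → h (suc i) k l ≡ h i k l
  h-keep {i} {k} {l} a a′ = trans (h≡ a′ (leftKeep a′ (toLeft i k l a))) (sym (h≡ a (toLeft i k l a)))

  -- No antichain has further points in the rectangle between the two: `left-null` excludes the
  -- indices up to `i`, `right-null` the later ones. The extension thus adds `δ` at its end only,
  -- and `¬a` ensures that the ends differ.
  h-step : ∀ {i k l k′ l′} → A i k l ≡ true → A (suc i) k l ≡ false → A (suc i) k′ l′ ≡ true →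
           k ≤ k′ → l ≤ l′ → h (suc i) k′ l′ ≡ h i k l + δ k′ l′
  h-step {i} {k} {l} {k′} {l′} a ¬a a′ k≤k′ l≤l′ =
    trans (h≡ a′ (leftExtend L a′ ρ))
      (trans (total-++ δ (Left.path L) ρ)
        (cong₂ _+_ (sym (h≡ a L)) (after-end δ (At.k<l a) ρ
          (λ { (refl , refl) → true≢false a′ ¬a })
          (λ r t r<t k≤r l≤t r≤k′ t≤l′ ≢p ≢q →
            null r t (ℕₚ.≤-trans (At.1≤k a) k≤r , r<t , ℕₚ.≤-trans t≤l′ (At.l≤n a′))
              (λ s → by r t k≤r l≤t r≤k′ t≤l′ ≢p ≢q s (ℕₚ.≤-<-connex s i))))))
    where
    L : Left i k l
    L = toLeft i k l a
    ρ : Path k l k′ l′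
    ρ = route k≤k′ l≤l′ (At.k<l a′)
    by : ∀ r t → k ≤ r → l ≤ t → r ≤ k′ → t ≤ l′ → ¬ (r ≡ k × t ≡ l) → ¬ (r ≡ k′ × t ≡ l′) →
         ∀ s → s ≤ i ⊎ i < s → A s r t ≡ false
    by r t k≤r l≤t r≤k′ t≤l′ ≢p ≢q s (inj₁ s≤i) = left-null L k≤r l≤t ≢p s s≤i
    by r t k≤r l≤t r≤k′ t≤l′ ≢p ≢q s (inj₂ i<s) = right-null (toRight (suc i) k′ l′ a′) r≤k′ t≤l′ ≢q s i<s

  module _ (i : ℕ) (1≤i : 1 ≤ i) (1+i<n : suc i < n) where

    open Neighbours (ac i) (ac (suc i)) (rigid i 1≤i 1+i<n)

    -- The value of h just before the step from A i to A (i+1), hence constant along comparabilities.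
    g : ℕ → ℕ → ℚ
    g k l = if A i k l then h i k l else h (suc i) k l - δ k l

    g-true : ∀ {k l} → A i k l ≡ true → g k l ≡ h i k l
    g-true {k} {l} a = cong (λ b → if b then h i k l else h (suc i) k l - δ k l) a

    g-false : ∀ {k l} → A i k l ≡ false → g k l ≡ h (suc i) k l - δ k l
    g-false {k} {l} a = cong (λ b → if b then h i k l else h (suc i) k l - δ k l) a

    nonzero : ℕ → ℕ → Bool
    nonzero k l = not (does (g k l ℚ.≟ 0ℚ))

    not-injective : ∀ {b} → not b ≡ false → b ≡ true
    not-injective {true} _ = refl

    const : ∀ {k l k′ l′} → A i k l ≡ true → A (suc i) k l ≡ false → A (suc i) k′ l′ ≡ true → A i k′ l′ ≡ false →
            Comparable k l k′ l′ → g k l ≡ g k′ l′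
    const {k} {l} {k′} {l′} a ¬a a′ ¬a′ comparable =
      let k≤k′ , l≤l′ = ascending a ¬a a′ comparable in
      trans (g-true a) (sym (trans (g-false ¬a′)
        (trans (cong (_- δ k′ l′) (h-step a ¬a a′ k≤k′ l≤l′)) (p+q-q (h i k l) (δ k′ l′)))))

    -- Rigidity applied to the set where `g` is nonzero. At points outside the common rectangle `g`
    -- is 0, by `h-end` for `A i` and by `h-start` for `A (suc i)`.
    g-vanishes : (∀ {k l} → A i k l ≡ true → A (suc i) k l ≡ false → nonzero k l ≡ false) ×
                 (∀ {k l} → A (suc i) k l ≡ true → A i k l ≡ false → nonzero k l ≡ false)
    g-vanishes = rigid i 1≤i 1+i<n nonzero
      (λ a ¬a a′ ¬a′ comparable → cong (λ q → not (does (q ℚ.≟ 0ℚ))) (const a ¬a a′ ¬a′ comparable))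
      (λ {k} a → cong not (dec-true (g k (suc i) ℚ.≟ 0ℚ) (trans (g-true a) (h-end a))))
      (λ {l} a ¬a → cong not (dec-true (g (suc i) l ℚ.≟ 0ℚ)
        (trans (g-false ¬a) (trans (cong (_- δ (suc i) l) (h-start a)) (p-p≡0 (δ (suc i) l))))))

    g≡0 : ∀ {k l} → nonzero k l ≡ false → g k l ≡ 0ℚ
    g≡0 {k} {l} e = does-true (g k l ℚ.≟ 0ℚ) (not-injective e)

    h-last : ∀ {k l} → A i k l ≡ true → A (suc i) k l ≡ false → h i k l ≡ 0ℚ
    h-last a ¬a = trans (sym (g-true a)) (g≡0 (proj₁ g-vanishes a ¬a))

    h-first : ∀ {k l} → A (suc i) k l ≡ true → A i k l ≡ false → h (suc i) k l ≡ δ k l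
    h-first {k} {l} a ¬a = trans (sym (p-q+q (h (suc i) k l) (δ k l)))
      (trans (cong (_+ δ k l) (trans (sym (g-false ¬a)) (g≡0 (proj₂ g-vanishes a ¬a)))) (ℚₚ.+-identityˡ (δ k l)))
      where
      p-q+q : ∀ p q → (p - q) + q ≡ p
      p-q+q = solve 2 (λ p q → (p :- q) :+ q := p) refl where open +-*-Solver

  -- Follow the point down to the first of the consecutive antichains that contain it. There `h` is
  -- `δ`, and `h-keep` carries this value back up.
  h≡δ : ∀ i k l → A i k l ≡ true → h i k l ≡ δ k l
  h≡δ zero    k l a = ⊥-elim (ℕₚ.n≮0 (At.1≤i a))
  h≡δ (suc i) k l a = by (ℕₚ.m≤n⇒m<n∨m≡n (At.k≤i a)) (A i k l Bool.≟ true)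
    where
    by : k < suc i ⊎ k ≡ suc i → Dec (A i k l ≡ true) → h (suc i) k l ≡ δ k l
    by (inj₂ refl)      _        = h-start a
    by (inj₁ _)         (yes a′) = trans (h-keep a′ a) (h≡δ i k l a′)
    by (inj₁ (s≤s k≤i)) (no ¬a)  =
      h-first i (ℕₚ.≤-trans (At.1≤k a) k≤i) (ℕₚ.<-≤-trans (At.i<l a) (At.l≤n a)) a (≢true ¬a)

  -- Follow the point up to the last of these antichains, where `h` is 0; `d` bounds the number of
  -- remaining indices.
  h≡0 : ∀ d i k l → n ≤ d ℕ.+ i → A i k l ≡ true → h i k l ≡ 0ℚ
  h≡0 zero    i k l n≤i a = ⊥-elim (ℕₚ.<⇒≱ (ℕₚ.<-≤-trans (At.i<l a) (At.l≤n a)) n≤i)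
  h≡0 (suc d) i k l n≤ a = by (ℕₚ.m≤n⇒m<n∨m≡n (At.i<l a)) (A (suc i) k l Bool.≟ true)
    where
    by : suc i < l ⊎ suc i ≡ l → Dec (A (suc i) k l ≡ true) → h i k l ≡ 0ℚ
    by (inj₂ refl) _        = h-end a
    by (inj₁ _)    (yes a′) = trans (sym (h-keep a a′))
      (h≡0 d (suc i) k l (ℕₚ.≤-trans n≤ (ℕₚ.≤-reflexive (sym (ℕₚ.+-suc d i)))) a′)
    by (inj₁ lt)   (no ¬a)  = h-last i (At.1≤i a) (ℕₚ.<-≤-trans lt (At.l≤n a)) a (≢true ¬a)

  δ≡0 : ∀ k l → InTri n k l → δ k l ≡ 0ℚ
  δ≡0 k l tri = by (ℕₚ.anyUpTo? (λ s → A s k l Bool.≟ true) n)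
    where
    by : Dec (∃ λ s → s < n × A s k l ≡ true) → δ k l ≡ 0ℚ
    by (yes (s , _ , a)) = trans (sym (h≡δ s k l a)) (h≡0 n s k l (ℕₚ.m≤m+n n s) a)
    by (no none)         = null k l tri (λ s → ≢true (λ a →
      none (s , ℕₚ.<-≤-trans (At.i<l a) (At.l≤n a) , a)))

-- Exchanging parts of two antichains

exchange : Bool → Bool → Bool → Bool
-- That is, `b` where `f` is true and `a` elsewhere.
exchange true  b f = b ∨ not f
exchange false b f = b ∧ f

χ-exchange : ∀ a b f → χ (exchange a b f) + χ (exchange b a f) ≡ χ a + χ b
χ-exchange true  true  true  = refl
χ-exchange true  true  false = refl
χ-exchange true  false true  = refl
χ-exchange true  false false = refl
χ-exchange false true  true  = refl
χ-exchange false true  false = refl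
χ-exchange false false true  = refl
χ-exchange false false false = refl

-- The three ways to belong to an exchanged set. `both` leaves `f` free, and such a point can be
-- used as a member of either antichain.
data Exchanged : Bool → Bool → Bool → Set where
  both  : ∀ {f} → Exchanged true true f
  kept  : Exchanged true false false
  taken : Exchanged false true true

exchanged : ∀ a b f → exchange a b f ≡ true → Exchanged a b f
exchanged true  true  f     _ = both
exchanged true  false false _ = kept
exchanged false true  true  _ = taken

module _ {n i i′ : ℕ} {A B f : ℕ → ℕ → Bool} (acA : Antichain n i A) (acB : Antichain n i′ B)
  (const : ∀ {k l k′ l′} → A k l ≡ true → B k l ≡ false → B k′ l′ ≡ true → A k′ l′ ≡ false →
     Comparable k l k′ l′ → f k l ≡ f k′ l′)
  (fits : ∀ {k l} → B k l ≡ true → f k l ≡ true → (1 ≤ k × k ≤ i) × (i < l × l ≤ n))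
  where

  -- Two kept points both come from `A` and two taken ones from `B`, so the given antichain
  -- properties apply. A comparable pair of a kept and a taken point would have the same value of
  -- `f` by `const`, but `f` is false at the one and true at the other.
  exchange-antichain : Antichain n i (λ k l → exchange (A k l) (B k l) (f k l))
  exchange-antichain = record
    { inside = λ {k} {l} p → inside′ k l refl refl refl (exchanged (A k l) (B k l) (f k l) p)
    ; anti   = λ {k} {l} {k′} {l′} p q →
        anti′ k l k′ l′ refl refl refl (exchanged (A k l) (B k l) (f k l) p)
                        refl refl refl (exchanged (A k′ l′) (B k′ l′) (f k′ l′) q) }
    where
    inside′ : ∀ k l {a b c} → A k l ≡ a → B k l ≡ b → f k l ≡ c → Exchanged a b c →
              (1 ≤ k × k ≤ i) × (i < l × l ≤ n)
    inside′ k l a b c both  = inside acA a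
    inside′ k l a b c kept  = inside acA a
    inside′ k l a b c taken = fits b c

    anti′ : ∀ k l k′ l′ {a b c a′ b′ c′} →
            A k l ≡ a → B k l ≡ b → f k l ≡ c → Exchanged a b c →
            A k′ l′ ≡ a′ → B k′ l′ ≡ b′ → f k′ l′ ≡ c′ → Exchanged a′ b′ c′ →
            k ≤ k′ → l ≤ l′ → k ≡ k′ × l ≡ l′
    anti′ k l k′ l′ a b c both  a′ b′ c′ both  = anti acA a a′
    anti′ k l k′ l′ a b c both  a′ b′ c′ kept  = anti acA a a′
    anti′ k l k′ l′ a b c kept  a′ b′ c′ both  = anti acA a a′
    anti′ k l k′ l′ a b c kept  a′ b′ c′ kept  = anti acA a a′
    anti′ k l k′ l′ a b c both  a′ b′ c′ taken = anti acB b b′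
    anti′ k l k′ l′ a b c taken a′ b′ c′ both  = anti acB b b′
    anti′ k l k′ l′ a b c taken a′ b′ c′ taken = anti acB b b′
    anti′ k l k′ l′ a b c kept  a′ b′ c′ taken = λ k≤ l≤ →
      ⊥-elim (true≢false c′ (trans (sym (const a b b′ a′ (inj₁ (k≤ , l≤)))) c))
    anti′ k l k′ l′ a b c taken a′ b′ c′ kept  = λ k≤ l≤ →
      ⊥-elim (true≢false c (trans (sym (const a′ b′ b a (inj₂ (k≤ , l≤)))) c′))

-- A point of `B` outside the rectangle of `A` has first coordinate `suc i`, where `f` is false by
-- hypothesis.
fits-lower : ∀ {n i A B} {f : ℕ → ℕ → Bool} → Antichain n i A → Antichain n (suc i) B →
  (∀ {l} → B (suc i) l ≡ true → A (suc i) l ≡ false → f (suc i) l ≡ false) →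
  ∀ {k l} → B k l ≡ true → f k l ≡ true → (1 ≤ k × k ≤ i) × (i < l × l ≤ n)
fits-lower acA acB startB b t with inside acB b
... | (1≤k , k≤1+i) , (1+i<l , l≤n) with ℕₚ.m≤n⇒m<n∨m≡n k≤1+i
...   | inj₁ (s≤s k≤i) = (1≤k , k≤i) , (ℕₚ.<⇒≤ 1+i<l , l≤n)
...   | inj₂ refl      = contradiction (startB b (≢true (λ a → ℕₚ.1+n≰n (proj₂ (proj₁ (inside acA a)))))) (true≢false t)

fits-upper : ∀ {n i A} {f : ℕ → ℕ → Bool} → Antichain n i A →
  (∀ {k} → A k (suc i) ≡ true → f k (suc i) ≡ false) →
  ∀ {k l} → A k l ≡ true → f k l ≡ true → (1 ≤ k × k ≤ suc i) × (suc i < l × l ≤ n)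
fits-upper acA endA a t with inside acA a
... | (1≤k , k≤i) , (i<l , l≤n) with ℕₚ.m≤n⇒m<n∨m≡n i<l
...   | inj₁ 1+i<l = (1≤k , ℕₚ.m≤n⇒m≤1+n k≤i) , (1+i<l , l≤n)
...   | inj₂ refl  = contradiction (endA a) (true≢false t)

toℚ-suc : ∀ c q → toℚ (suc c) * q ≡ toℚ c * q + q
toℚ-suc c q = trans (cong (_* q) (trans (toℚ-+ 1 c) (cong (_+ toℚ c) toℚ-1))) (lemma (toℚ c) q)
  where
  lemma : ∀ p q → (1ℚ + p) * q ≡ p * q + q
  lemma = solve 2 (λ p q → (con 1ℚ :+ p) :* q := p :* q :+ q) refl where open +-*-Solver

-- If f were true somewhere, exchanging the points of A and B where it is true would give a second
-- decomposition y + z of v + w, and v + w would be the midpoint of v + z and y + w.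
vertex⇒rigid : ∀ {n i A B v w} c d → Antichain n i A → Antichain n (suc i) B →
  FFLV n (single i (suc c)) v → FFLV n (single (suc i) (suc d)) w →
  (∀ k l → InTri n k l → v k l ≡ toℚ (suc c) * 𝟙 A k l) →
  (∀ k l → InTri n k l → w k l ≡ toℚ (suc d) * 𝟙 B k l) →
  IsVertex n (Mink n (FFLV n (single i (suc c))) (FFLV n (single (suc i) (suc d)))) (v +ₚ w) →
  Rigid i A B
vertex⇒rigid {n} {i} {A} {B} {v} {w} c d acA acB Pv Pw v≡ w≡ (_ , extreme) f const endA startB =
    (λ {k} {l} a ¬b → ≢true (λ t → absurd₁ (at k l (inTri acA a) a ¬b t)))
  , (λ {k} {l} b ¬a → ≢true (λ t → absurd₂ (at k l (inTri acB b) ¬a b t)))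
  where
  A′ B′ : ℕ → ℕ → Bool
  A′ k l = exchange (A k l) (B k l) (f k l)
  B′ k l = exchange (B k l) (A k l) (f k l)

  acA′ : Antichain n i A′
  acA′ = exchange-antichain {f = f} acA acB const (fits-lower {f = f} acA acB startB)

  acB′ : Antichain n (suc i) B′
  acB′ = exchange-antichain {f = f} acB acA (λ b ¬a a ¬b cmp → sym (const a ¬b b ¬a (swap cmp))) (fits-upper {f = f} acA endA)

  y z : Pt
  -- Only one of the `suc c` copies of `A` is exchanged with one of the `suc d` copies of `B`, so
  -- that the sum is preserved even when `c` and `d` differ.
  y = (toℚ c ·ₚ 𝟙 A) +ₚ 𝟙 A′
  z = (toℚ d ·ₚ 𝟙 B) +ₚ 𝟙 B′

  module _ (k l : ℕ) (tri : InTri n k l) where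
    p q : ℚ
    p = toℚ c * 𝟙 A k l
    q = toℚ d * 𝟙 B k l

    v≡p : v k l ≡ p + 𝟙 A k l
    v≡p = trans (v≡ k l tri) (toℚ-suc c (𝟙 A k l))

    w≡q : w k l ≡ q + 𝟙 B k l
    w≡q = trans (w≡ k l tri) (toℚ-suc d (𝟙 B k l))

    midpoint : v k l + w k l ≡ ½ * (v k l + z k l) + ½ * (y k l + w k l)
    midpoint = trans (halve (v k l + w k l)) (trans (cong (½ *_) double)
      (ℚₚ.*-distribˡ-+ ½ (v k l + z k l) (y k l + w k l)))
      where
      y+z : y k l + z k l ≡ v k l + w k l
      y+z = trans (+-interchange p (𝟙 A′ k l) q (𝟙 B′ k l))
        (trans (cong ((p + q) +_) (χ-exchange (A k l) (B k l) (f k l)))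
          (trans (+-interchange p q (𝟙 A k l) (𝟙 B k l)) (sym (cong₂ _+_ v≡p w≡q))))
      regroup : ∀ v w y z → (v + w) + (y + z) ≡ (v + z) + (y + w)
      regroup = solve 4 (λ v w y z → (v :+ w) :+ (y :+ z) := (v :+ z) :+ (y :+ w)) refl where open +-*-Solver
      double : (v k l + w k l) + (v k l + w k l) ≡ (v k l + z k l) + (y k l + w k l)
      double = trans (cong ((v k l + w k l) +_) (sym y+z)) (regroup (v k l) (w k l) (y k l) (z k l))

  same : ∀ k l → InTri n k l → v k l + z k l ≡ y k l + w k l
  same k l (1≤k , k<l , l≤n) = extreme (v +ₚ z) (y +ₚ w) ½
    (v , z , Pv , antichains-FFLV d acB acB′ , λ _ _ _ _ _ → refl)
    (y , w , antichains-FFLV c acA acA′ , Pw , λ _ _ _ _ _ → refl)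
    (ℚₚ.positive⁻¹ ½) ½<1 (λ k l 1≤k k<l l≤n → midpoint k l (1≤k , k<l , l≤n)) k l 1≤k k<l l≤n

  indicators : ∀ k l → InTri n k l → 𝟙 A k l + 𝟙 B′ k l ≡ 𝟙 A′ k l + 𝟙 B k l
  indicators k l tri = trans (sym (cancel (p k l tri) (𝟙 A k l) (q k l tri) (𝟙 B′ k l)))
    (trans (cong (_- (p k l tri + q k l tri))
        (trans (cong (_+ z k l) (sym (v≡p k l tri))) (trans (same k l tri) (cong (y k l +_) (w≡q k l tri)))))
      (cancel (p k l tri) (𝟙 A′ k l) (q k l tri) (𝟙 B k l)))
    where
    cancel : ∀ p r q s → ((p + r) + (q + s)) - (p + q) ≡ r + s
    cancel = solve 4 (λ p r q s → ((p :+ r) :+ (q :+ s)) :- (p :+ q) := r :+ s) refl where open +-*-Solver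

  -- At a point of exactly one antichain this equation reads `1 + 1 = 0 + 0` or its reverse.
  at : ∀ k l → InTri n k l → ∀ {a b} → A k l ≡ a → B k l ≡ b → f k l ≡ true →
       χ a + χ (exchange b a true) ≡ χ (exchange a b true) + χ b
  at k l tri refl refl t = trans (cong (λ u → 𝟙 A k l + χ (exchange (B k l) (A k l) u)) (sym t))
    (trans (indicators k l tri) (cong (λ u → χ (exchange (A k l) (B k l) u) + 𝟙 B k l) t))

  absurd₁ : ¬ (1ℚ + 1ℚ ≡ 0ℚ + 0ℚ)
  absurd₁ ()

  absurd₂ : ¬ (0ℚ + 0ℚ ≡ 1ℚ + 1ℚ)
  absurd₂ ()

-- Sums of points of the polytopes

module _ {m : ℕ} (a : ℕ → ℕ) (w : ℕ → Pt)
  (P : ∀ s → s < m → FFLV (suc m) (single (suc s) (a (suc s))) (w (suc s))) where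

  total-sumPts : ∀ {j j′} → 1 ≤ j → j′ < suc m → (π : DyckPath j j′) →
                 total (sumPts w 1 m) π ≡ sumℚ m (λ s → total (w (suc s)) π)
  total-sumPts 1≤j j′<n π = trans
    (total-cong (sumPts w 1 m) (λ r t → sumℚ m (λ s → w (suc s) r t)) 1≤j ℕₚ.≤-refl j′<n π
      (λ r t _ → sumPts≡sumℚ w m r t))
    (total-sum m (λ s → w (suc s)) π)

  -- Both sides of every path inequality are additive over the summands, the right one by
  -- `weight-split`.
  sum-FFLV : FFLV (suc m) a (sumPts w 1 m)
  sum-FFLV = path-FFLV (suc m) a (sumPts w 1 m)
    (λ k l (1≤k , k<l , l≤n) → subst (0ℚ ℚ.≤_) (sym (sumPts≡sumℚ w m k l))
      (ℚₚ.≤-trans (ℚₚ.≤-reflexive (sym (sumℚ-zero m (λ _ _ → refl))))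
        (sumℚ-mono m (λ s s<m → proj₁ (P s s<m) k l 1≤k k<l l≤n))))
    (λ {j} {j′} 1≤j j′<n π → subst₂ ℚ._≤_ (sym (total-sumPts 1≤j j′<n π))
      (sym (weight-split a m 1≤j (ℕₚ.≤-pred j′<n)))
      (sumℚ-mono m (λ s s<m → FFLV-path (suc m) (single (suc s) (a (suc s))) (w (suc s)) (P s s<m) 1≤j j′<n π)))

sumℚ-pair : ∀ m s f g → suc s < m → (∀ r → r ≢ s → r ≢ suc s → f r ≡ g r) →
            sumℚ m f ≡ sumℚ m g + ((f s + f (suc s)) - (g s + g (suc s)))
sumℚ-pair m s f g s<m agree = trans (sumℚ-cong m (λ r _ → split (f r) (g r)))
  (trans (sumℚ-+ m g (λ r → f r - g r))
    (cong (sumℚ m g +_) (trans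
      (sumℚ-pick₂ m s (λ r → f r - g r) s<m (λ r ≢s ≢1+s → trans (cong (_- g r) (agree r ≢s ≢1+s)) (p-p≡0 (g r))))
      ([p-q]+[r-s] (f s) (g s) (f (suc s)) (g (suc s))))))
  where
  split : ∀ p q → p ≡ q + (p - q)
  split = solve 2 (λ p q → p := q :+ (p :- q)) refl where open +-*-Solver

replace : ℕ → Pt → Pt → (ℕ → Pt) → ℕ → Pt
replace i x y v s = if does (s ℕ.≟ i) then x else if does (s ℕ.≟ suc i) then y else v s

module _ (i : ℕ) (x y : Pt) (v : ℕ → Pt) where

  replace-first : replace i x y v i ≡ x
  replace-first = cong (λ b → if b then x else if does (i ℕ.≟ suc i) then y else v i) (dec-true (i ℕ.≟ i) refl)

  replace-second : replace i x y v (suc i) ≡ y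
  replace-second = trans
    (cong (λ b → if b then x else if does (suc i ℕ.≟ suc i) then y else v (suc i)) (dec-false (suc i ℕ.≟ i) ℕₚ.1+n≢n))
    (cong (λ b → if b then y else v (suc i)) (dec-true (suc i ℕ.≟ suc i) refl))

  replace-other : ∀ s → s ≢ i → s ≢ suc i → replace i x y v s ≡ v s
  replace-other s ≢i ≢1+i = trans
    (cong (λ b → if b then x else if does (s ℕ.≟ suc i) then y else v s) (dec-false (s ℕ.≟ i) ≢i))
    (cong (λ b → if b then y else v s) (dec-false (s ℕ.≟ suc i) ≢1+i))

  replace-elim : (Q : ℕ → Pt → Set) → Q i x → Q (suc i) y → ∀ s → Q s (v s) → Q s (replace i x y v s)
  replace-elim Q qx qy s qv = by (s ℕ.≟ i) (s ℕ.≟ suc i)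
    where
    by : Dec (s ≡ i) → Dec (s ≡ suc i) → Q s (replace i x y v s)
    by (yes refl) _          = subst (Q s) (sym replace-first) qx
    by (no _)     (yes refl) = subst (Q s) (sym replace-second) qy
    by (no ≢i)    (no ≢1+i)  = subst (Q s) (sym (replace-other s ≢i ≢1+i)) qv

-- Convex combinations

convex-min : ∀ α β p q → 0ℚ ℚ.< α → 0ℚ ℚ.< β → 0ℚ ℚ.≤ q → α * p + β * q ℚ.≤ 0ℚ → p ℚ.≤ 0ℚ
convex-min α β p q 0<α 0<β 0≤q sum≤0 = ℚₚ.≮⇒≥ (λ 0<p → ℚₚ.<-irrefl refl (ℚₚ.<-≤-trans (pos 0<p) sum≤0))
  where
  αp : 0ℚ ℚ.< p → 0ℚ ℚ.< α * p
  αp 0<p = ℚₚ.≤-<-trans (ℚₚ.≤-reflexive (sym (ℚₚ.*-zeroʳ α))) (ℚₚ.*-monoʳ-<-pos α {{ℚ.positive 0<α}} 0<p)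
  βq : 0ℚ ℚ.≤ β * q
  βq = ℚₚ.≤-trans (ℚₚ.≤-reflexive (sym (ℚₚ.*-zeroʳ β))) (*-monoˡ-nonneg β (ℚₚ.<⇒≤ 0<β) 0≤q)
  pos : 0ℚ ℚ.< p → 0ℚ ℚ.< α * p + β * q
  pos 0<p = ℚₚ.<-≤-trans (αp 0<p) (≤-+ʳ ℚₚ.≤-refl βq)

module Convex {t : ℚ} (0<t : 0ℚ ℚ.< t) (t<1 : t ℚ.< 1ℚ) where

  0<1-t : 0ℚ ℚ.< 1ℚ - t
  0<1-t = ℚₚ.≤-<-trans (ℚₚ.≤-reflexive (sym (p-p≡0 t))) (ℚₚ.+-monoˡ-< (- t) t<1)

  commute : ∀ p q → t * p + (1ℚ - t) * q ≡ (1ℚ - t) * q + t * p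
  commute p q = ℚₚ.+-comm (t * p) ((1ℚ - t) * q)

  zero-both : ∀ p q → 0ℚ ℚ.≤ p → 0ℚ ℚ.≤ q → t * p + (1ℚ - t) * q ℚ.≤ 0ℚ → p ≡ q
  zero-both p q 0≤p 0≤q le = trans
    (ℚₚ.≤-antisym (convex-min t (1ℚ - t) p q 0<t 0<1-t 0≤q le) 0≤p)
    (ℚₚ.≤-antisym 0≤q (convex-min (1ℚ - t) t q p 0<1-t 0<t 0≤p (subst (ℚ._≤ 0ℚ) (commute p q) le)))

  -- Apply `zero-both` to the slacks `W - p` and `W - q`, which are nonnegative and whose
  -- combination is at most 0.
  max-both : ∀ W p q → p ℚ.≤ W → q ℚ.≤ W → W ℚ.≤ t * p + (1ℚ - t) * q → p ≡ q
  max-both W p q p≤W q≤W le = trans (sym (restore W p)) (trans (cong (λ r → W - r) same) (restore W q))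
    where
    restore : ∀ W p → W - (W - p) ≡ p
    restore = solve 2 (λ W p → W :- (W :- p) := p) refl where open +-*-Solver
    expand : ∀ t W p q → t * (W - p) + (1ℚ - t) * (W - q) ≡ W - (t * p + (1ℚ - t) * q)
    expand = solve 4 (λ t W p q → t :* (W :- p) :+ (con 1ℚ :- t) :* (W :- q) :=
                                  W :- (t :* p :+ (con 1ℚ :- t) :* q)) refl where open +-*-Solver
    same : W - p ≡ W - q
    same = zero-both (W - p) (W - q) (0≤q-p p≤W) (0≤q-p q≤W)
      (ℚₚ.≤-trans (ℚₚ.≤-reflexive (expand t W p q))
        (ℚₚ.≤-trans (ℚₚ.+-monoˡ-≤ (- (t * p + (1ℚ - t) * q)) le)
          (ℚₚ.≤-reflexive (p-p≡0 (t * p + (1ℚ - t) * q)))))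

-- The two directions of the equivalence

module Main (m : ℕ) (a : ℕ → ℕ) (positive : ∀ i → 1 ≤ i → i ≤ m → 0 < a i) (v : ℕ → Pt)
  (vertices : ∀ i → 1 ≤ i → i ≤ m → IsVertex (suc m) (FFLV (suc m) (single i (a i))) (v i)) where

  n : ℕ
  n = suc m

  Pᵥ : ∀ s → s < m → FFLV n (single (suc s) (a (suc s))) (v (suc s))
  Pᵥ s s<m = proj₁ (vertices (suc s) (s≤s z≤n) s<m)

  PairVertex : ℕ → Set
  PairVertex i = IsVertex n (Mink n (FFLV n (single i (a i))) (FFLV n (single (suc i) (a (suc i)))))
                            (v i +ₚ v (suc i))

  module Forward (vertex : IsVertex n (FFLV n a) (sumPts v 1 m)) (s : ℕ) (s<m : suc s < m) where

    i : ℕ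
    i = suc s

    module Sum (x₁ x₂ : Pt) (P₁ : FFLV n (single i (a i)) x₁) (P₂ : FFLV n (single (suc i) (a (suc i))) x₂) where

      w : ℕ → Pt
      w = replace i x₁ x₂ v

      w-FFLV : FFLV n a (sumPts w 1 m)
      w-FFLV = sum-FFLV a w (λ r r<m →
        replace-elim i x₁ x₂ v (λ r → FFLV n (single r (a r))) P₁ P₂ (suc r) (Pᵥ r r<m))

      w-pair : ∀ k l → w i k l + w (suc i) k l ≡ x₁ k l + x₂ k l
      w-pair k l = cong₂ (λ x y → x k l + y k l) (replace-first i x₁ x₂ v) (replace-second i x₁ x₂ v)

      w-other : ∀ k l r → r ≢ s → r ≢ suc s → w (suc r) k l ≡ v (suc r) k l
      w-other k l r ≢s ≢1+s =
        cong (λ x → x k l) (replace-other i x₁ x₂ v (suc r) (≢s ∘ ℕₚ.suc-injective) (≢1+s ∘ ℕₚ.suc-injective))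

    forward : PairVertex i
    forward = (v i , v (suc i) , Pᵥ s (ℕₚ.<⇒≤ s<m) , Pᵥ (suc s) s<m , λ _ _ _ _ _ → refl) , extreme
      where
      extreme : ∀ y z t → Mink n (FFLV n (single i (a i))) (FFLV n (single (suc i) (a (suc i)))) y →
                Mink n (FFLV n (single i (a i))) (FFLV n (single (suc i) (a (suc i)))) z →
                0ℚ ℚ.< t → t ℚ.< 1ℚ → (v i +ₚ v (suc i)) ≐[ n ] ((t ·ₚ y) +ₚ ((1ℚ - t) ·ₚ z)) → y ≐[ n ] z
      extreme y z t (y₁ , y₂ , Py₁ , Py₂ , y≐) (z₁ , z₂ , Pz₁ , Pz₂ , z≐) 0<t t<1 eq k l 1≤k k<l l≤n =
        trans (y≐ k l 1≤k k<l l≤n) (trans pair≡ (sym (z≐ k l 1≤k k<l l≤n)))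
        where
        -- In the whole sum the pair `v i`, `v (suc i)` is replaced by the summands of `y`,
        -- respectively of `z`.
        module Y = Sum y₁ y₂ Py₁ Py₂
        module Z = Sum z₁ z₂ Pz₁ Pz₂

        mix : ℚ → ℚ → ℚ
        mix p q = t * p + (1ℚ - t) * q

        mix-same : ∀ p → p ≡ mix p p
        mix-same p = lemma t p
          where
          lemma : ∀ t p → p ≡ t * p + (1ℚ - t) * p
          lemma = solve 2 (λ t p → p := t :* p :+ (con 1ℚ :- t) :* p) refl where open +-*-Solver

        mix-+ : ∀ p q r s → mix (p + q) (r + s) ≡ mix p r + mix q s
        mix-+ = lemma t
          where
          lemma : ∀ t p q r s → t * (p + q) + (1ℚ - t) * (r + s) ≡ (t * p + (1ℚ - t) * r) + (t * q + (1ℚ - t) * s)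
          lemma = solve 5 (λ t p q r s → t :* (p :+ q) :+ (con 1ℚ :- t) :* (r :+ s) :=
            (t :* p :+ (con 1ℚ :- t) :* r) :+ (t :* q :+ (con 1ℚ :- t) :* s)) refl where open +-*-Solver

        combination : ∀ k l → 1 ≤ k → k < l → l ≤ n →
                      sumPts v 1 m k l ≡ mix (sumPts Y.w 1 m k l) (sumPts Z.w 1 m k l)
        -- Outside the pair each `v (suc r)` is the combination of itself with itself, so the two
        -- sides can differ only in the pair, where `eq` applies.
        combination k l 1≤k k<l l≤n = trans (sumPts≡sumℚ v m k l)
          (trans (sumℚ-pair m s f g s<m (λ r ≢s ≢1+s → trans (mix-same (v (suc r) k l))
              (cong₂ mix (sym (Y.w-other k l r ≢s ≢1+s)) (sym (Z.w-other k l r ≢s ≢1+s)))))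
            (trans (cong (λ q → sumℚ m g + (q - (g s + g (suc s)))) pair)
              (trans (cong (sumℚ m g +_) (p-p≡0 (g s + g (suc s)))) (trans (ℚₚ.+-identityʳ (sumℚ m g)) sum-mix))))
          where
          f g : ℕ → ℚ
          f r = v (suc r) k l
          g r = mix (Y.w (suc r) k l) (Z.w (suc r) k l)
          pair : f s + f (suc s) ≡ g s + g (suc s)
          pair = trans (eq k l 1≤k k<l l≤n) (trans
            (cong₂ mix (trans (y≐ k l 1≤k k<l l≤n) (sym (Y.w-pair k l))) (trans (z≐ k l 1≤k k<l l≤n) (sym (Z.w-pair k l))))
            (mix-+ (Y.w i k l) (Y.w (suc i) k l) (Z.w i k l) (Z.w (suc i) k l)))
          sum-mix : sumℚ m g ≡ mix (sumPts Y.w 1 m k l) (sumPts Z.w 1 m k l)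
          sum-mix = trans (sumℚ-+ m (λ r → t * Y.w (suc r) k l) (λ r → (1ℚ - t) * Z.w (suc r) k l))
            (cong₂ _+_
              (trans (sumℚ-* m t (λ r → Y.w (suc r) k l)) (cong (t *_) (sym (sumPts≡sumℚ Y.w m k l))))
              (trans (sumℚ-* m (1ℚ - t) (λ r → Z.w (suc r) k l)) (cong ((1ℚ - t) *_) (sym (sumPts≡sumℚ Z.w m k l)))))

        sums≡ : sumℚ m (λ r → Y.w (suc r) k l) ≡ sumℚ m (λ r → Z.w (suc r) k l)
        sums≡ = trans (sym (sumPts≡sumℚ Y.w m k l)) (trans
          (proj₂ vertex (sumPts Y.w 1 m) (sumPts Z.w 1 m) t Y.w-FFLV Z.w-FFLV 0<t t<1 combination k l 1≤k k<l l≤n)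
          (sumPts≡sumℚ Z.w m k l))

        cancel : ∀ S p q → S ≡ S + (p - q) → p ≡ q
        cancel S p q e = trans (sym (lemma S p q)) (trans (cong (λ r → (r - S) + q) (sym e)) (lemma′ S q))
          where
          open +-*-Solver
          lemma : ∀ S p q → ((S + (p - q)) - S) + q ≡ p
          lemma = solve 3 (λ S p q → ((S :+ (p :- q)) :- S) :+ q := p) refl
          lemma′ : ∀ S q → (S - S) + q ≡ q
          lemma′ = solve 2 (λ S q → (S :- S) :+ q := q) refl

        pair≡ : y₁ k l + y₂ k l ≡ z₁ k l + z₂ k l
        -- The two full sums agree by extremality, and so do their terms outside the pair; hence the
        -- pairs have equal sums.
        pair≡ = trans (sym (Y.w-pair k l)) (trans
          (cancel (sumℚ m (λ r → Z.w (suc r) k l)) (Y.w i k l + Y.w (suc i) k l) (Z.w i k l + Z.w (suc i) k l)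
            (trans (sym sums≡) (sumℚ-pair m s (λ r → Y.w (suc r) k l) (λ r → Z.w (suc r) k l) s<m
              (λ r ≢s ≢1+s → trans (Y.w-other k l r ≢s ≢1+s) (sym (Z.w-other k l r ≢s ≢1+s))))))
          (Z.w-pair k l))

  module Backward (pairs : ∀ i → 1 ≤ i → suc i ≤ m → PairVertex i) where

    A : ℕ → ℕ → ℕ → Bool
    A s = support n s (a s) (v s)

    in-support : ∀ s k l → A s k l ≡ true → InSupport n s (a s) (v s) k l
    in-support s k l = does-true (inSupport? n s (a s) (v s) k l)

    index : ∀ s k l → A s k l ≡ true → 1 ≤ s × s ≤ m
    index s k l p = let (1≤k , k≤s) , (s<l , l≤n) = proj₁ (in-support s k l p)
                    in ℕₚ.≤-trans 1≤k k≤s , ℕₚ.≤-pred (ℕₚ.≤-trans s<l l≤n)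

    -- This covers also those `s` for which `v s` is not assumed to be a vertex: the rectangle built
    -- into the support lets a point of `A s` exist only if `1 ≤ s ≤ m`.
    ac : ∀ s → Antichain n s (A s)
    ac s = record
      { inside = λ {k} {l} p → proj₁ (in-support s k l p)
      ; anti   = λ {k} {l} p → let 1≤s , s≤m = index s k l p in
                   anti (support-antichain n s (a s) (positive s 1≤s s≤m) (v s) (vertices s 1≤s s≤m)) p }

    v≡ : ∀ s → 1 ≤ s → s ≤ m → ∀ k l → InTri n k l → v s k l ≡ toℚ (a s) * 𝟙 (A s) k l
    v≡ s 1≤s s≤m = vertex≡support n s (a s) (positive s 1≤s s≤m) (v s) (vertices s 1≤s s≤m)

    rigid : ∀ i → 1 ≤ i → suc i < n → Rigid i (A i) (A (suc i))
    rigid i 1≤i (s≤s 1+i≤m) = by (a i) (a (suc i)) refl refl (positive i 1≤i i≤m) (positive (suc i) (s≤s z≤n) 1+i≤m)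
      where
      i≤m : i ≤ m
      i≤m = ℕₚ.<⇒≤ 1+i≤m
      by : ∀ c d → c ≡ a i → d ≡ a (suc i) → 0 < c → 0 < d → Rigid i (A i) (A (suc i))
      by (suc c) (suc d) c≡ d≡ _ _ = vertex⇒rigid {v = v i} {w = v (suc i)} c d (ac i) (ac (suc i))
        (subst (λ e → FFLV n (single i e) (v i)) (sym c≡) (proj₁ (vertices i 1≤i i≤m)))
        (subst (λ e → FFLV n (single (suc i) e) (v (suc i))) (sym d≡) (proj₁ (vertices (suc i) (s≤s z≤n) 1+i≤m)))
        (λ k l tri → trans (v≡ i 1≤i i≤m k l tri) (cong (λ e → toℚ e * 𝟙 (A i) k l) (sym c≡)))
        (λ k l tri → trans (v≡ (suc i) (s≤s z≤n) 1+i≤m k l tri) (cong (λ e → toℚ e * 𝟙 (A (suc i)) k l) (sym d≡)))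
        (subst₂ (λ e e′ → IsVertex n (Mink n (FFLV n (single i e)) (FFLV n (single (suc i) e′))) (v i +ₚ v (suc i)))
          (sym c≡) (sym d≡) (pairs i 1≤i 1+i≤m))

    -- For each `s` in the range the path passes a point where `v s` has the value `a s`, which is
    -- already the full bound. The remaining summands contribute at least their bound 0.
    sum-tight : ∀ {j j′} → 1 ≤ j → j′ < n → (π : DyckPath j j′) →
                (∀ s → j ≤ s → s ≤ j′ → Hit (A s) π) → toℚ (rangeSum a j j′) ℚ.≤ total (sumPts v 1 m) π
    sum-tight {j} {j′} 1≤j j′<n π hit = subst₂ ℚ._≤_ (sym (weight-split a m 1≤j (ℕₚ.≤-pred j′<n)))
      (sym (total-sumPts a v Pᵥ 1≤j j′<n π))
      (sumℚ-mono m (λ s s<m → by s s<m (in-or-out (suc s) j j′)))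
      where
      by : ∀ s → s < m → (j ≤ suc s × suc s ≤ j′) ⊎ (suc s < j ⊎ j′ < suc s) →
           toℚ (rangeSum (single (suc s) (a (suc s))) j j′) ℚ.≤ total (v (suc s)) π
      by s s<m (inj₁ (p , q)) =
        let r , t , α , on = hit (suc s) p q in ℚₚ.≤-trans (ℚₚ.≤-reflexive (trans (weight-in (suc s) (a (suc s)) j j′ p q)
              (sym (proj₂ (in-support (suc s) r t α)))))
            (total-≥ (v (suc s)) (λ r t (1≤r , r<t , t≤n) → proj₁ (Pᵥ s s<m) r t 1≤r r<t t≤n) 1≤j ℕₚ.≤-refl j′<n on)
      by s s<m (inj₂ out) = ℚₚ.≤-trans (ℚₚ.≤-reflexive (weight-out (suc s) (a (suc s)) j j′ out))
        (total-nonneg (v (suc s)) (λ r t (1≤r , r<t , t≤n) → proj₁ (Pᵥ s s<m) r t 1≤r r<t t≤n) 1≤j ℕₚ.≤-refl j′<n π)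

    backward : IsVertex n (FFLV n a) (sumPts v 1 m)
    backward = sum-FFLV a v Pᵥ , extreme
      where
      extreme : ∀ y z t → FFLV n a y → FFLV n a z → 0ℚ ℚ.< t → t ℚ.< 1ℚ →
                sumPts v 1 m ≐[ n ] ((t ·ₚ y) +ₚ ((1ℚ - t) ·ₚ z)) → y ≐[ n ] z
      extreme y z t Py Pz 0<t t<1 eq k l 1≤k k<l l≤n =
        ≡-from-difference (y k l) (z k l) (Potential.δ≡0 n A ac rigid δ null tight k l (1≤k , k<l , l≤n))
        where
        open Convex 0<t t<1

        δ : Pt
        -- In this form path sums of `δ` split by `total-+` and `total-·`.
        δ = y +ₚ ((- 1ℚ) ·ₚ z)

        difference : ∀ p q → p ≡ q → p + - 1ℚ * q ≡ 0ℚ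
        difference p .p refl = lemma p
          where
          lemma : ∀ p → p + - 1ℚ * p ≡ 0ℚ
          lemma = solve 1 (λ p → p :+ (:- con 1ℚ) :* p := con 0ℚ) refl where open +-*-Solver

        ≡-from-difference : ∀ p q → p + - 1ℚ * q ≡ 0ℚ → p ≡ q
        ≡-from-difference p q e = trans (sym (lemma p q)) (trans (cong (_+ q) e) (ℚₚ.+-identityˡ q))
          where
          lemma : ∀ p q → (p + - 1ℚ * q) + q ≡ p
          lemma = solve 2 (λ p q → (p :+ (:- con 1ℚ) :* q) :+ q := p) refl where open +-*-Solver

        null : ∀ k l → InTri n k l → (∀ s → A s k l ≡ false) → δ k l ≡ 0ℚ
        -- All summands vanish at this point, so the combination of the nonnegative `y k l` and
        -- `z k l` is 0.
        null k l tri@(1≤k , k<l , l≤n) none = difference (y k l) (z k l)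
          (zero-both (y k l) (z k l) (proj₁ Py k l 1≤k k<l l≤n) (proj₁ Pz k l 1≤k k<l l≤n)
            (ℚₚ.≤-reflexive (trans (sym (eq k l 1≤k k<l l≤n)) (trans (sumPts≡sumℚ v m k l)
              (sumℚ-zero m (λ s s<m → trans (v≡ (suc s) (s≤s z≤n) s<m k l tri)
                (trans (cong (λ b → toℚ (a (suc s)) * χ b) (none (suc s))) (ℚₚ.*-zeroʳ (toℚ (a (suc s)))))))))))

        tight : ∀ {j j′} → 1 ≤ j → j′ < n → (π : DyckPath j j′) →
                (∀ s → j ≤ s → s ≤ j′ → Hit (A s) π) → total δ π ≡ 0ℚ
        -- Neither `total y π` nor `total z π` exceeds the bound, and their combination reaches it
        -- by `sum-tight`.
        tight {j} {j′} 1≤j j′<n π hit = trans (total-+ y ((- 1ℚ) ·ₚ z) π)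
          (trans (cong (total y π +_) (total-· (- 1ℚ) z π)) (difference (total y π) (total z π)
            (max-both (toℚ (rangeSum a j j′)) (total y π) (total z π)
              (FFLV-path n a y Py 1≤j j′<n π) (FFLV-path n a z Pz 1≤j j′<n π)
              (ℚₚ.≤-trans (sum-tight 1≤j j′<n π hit) (ℚₚ.≤-reflexive
                (trans (total-cong (sumPts v 1 m) ((t ·ₚ y) +ₚ ((1ℚ - t) ·ₚ z)) 1≤j ℕₚ.≤-refl j′<n π
                    (λ r u (1≤r , r<u , u≤n) → eq r u 1≤r r<u u≤n))
                  (trans (total-+ (t ·ₚ y) ((1ℚ - t) ·ₚ z) π)
                    (cong₂ _+_ (total-· t y π) (total-· (1ℚ - t) z π)))))))))

theorem1p1 : (n : ℕ) → 2 ≤ n → (a : ℕ → ℕ) →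
    (∀ i → 1 ≤ i → i ≤ n ∸ 1 → 0 < a i) →
    (v : ℕ → Pt) →
    (∀ i → 1 ≤ i → i ≤ n ∸ 1 → IsVertex n (FFLV n (single i (a i))) (v i)) →
    IsVertex n (FFLV n a) (sumPts v 1 (n ∸ 1))
    ⇔ (∀ i → 1 ≤ i → i ≤ n ∸ 2 →
    IsVertex n (Mink n (FFLV n (single i (a i))) (FFLV n (single (suc i) (a (suc i)))))
    (v i +ₚ v (suc i)))
theorem1p1 (suc (suc m)) (s≤s (s≤s _)) a positive v vertices = mk⇔
  (λ { vertex (suc s) _ 1+s≤m → Forward.forward vertex s (s≤s 1+s≤m) })
  (λ pairs → Backward.backward (λ { i 1≤i (s≤s i≤m) → pairs i 1≤i i≤m }))
  where open Main (suc m) a positive v vertices
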